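{- There exist infinitely many nonnegative integers $n$ such that $s_2(n)=s_3(n)$. More precisely, for every real $\delta>0$ there is a constant $c=c(\delta)>0$ such that for all integers $N\ge 1$ $$\#\bigl\{0\le n<N: s_2(n)=s_3(n)\bigr\}\ \ge\ c\,N^{\frac{\log 3}{\log 4}-\delta}.$$
   Context: For an integer $q\ge 2$ and a nonnegative integer $n$, $s_q(n)$ denotes the sum of the digits of $n$ in its base-$q$ expansion. $\log$ is the natural logarithm. -}

module Defs where

open import Algebra.Definitions.RawSemiring using () renaming (_^_ to pow)
open import Data.Digit using (toDigits)
open import Data.Fin.Base using (toℕ)
open import Data.Integer.Base using (+_)
open import Data.List.Base using (List; length; filter; map; upTo)
open import Data.Nat.Base as ℕ using (ℕ; suc)
open import Data.Nat.ListAction using (sum)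
import Data.Nat.Properties as ℕ
open import Data.Product.Base using (_×_; ∃-syntax; proj₁)
open import Data.Rational.Base
open import Data.Sum.Base using (_⊎_)
open import Relation.Nullary.Decidable using (True)
open import Relation.Nullary.Negation using (¬_)

------------------------------------------------------------------------
-- Digit sums

digitSum : (q : ℕ) {q≥2 : True (2 ℕ.≤? q)} → ℕ → ℕ
digitSum q {q≥2} n = sum (map toℕ (proj₁ (toDigits q {q≥2} n)))

collisions : ℕ → ℕ
collisions N = length (filter (λ n → digitSum 2 n ℕ.≟ digitSum 3 n) (upTo N))

------------------------------------------------------------------------
-- Real numbers as Dedekind cuts
--
-- A `Cut` is the raw data of a cut: `lower x q` stands for q < x and
-- `upper x q` for x < q.  It is a real number when `IsReal` holds.  The
-- operations below are given on raw cuts, and denote the usual ones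
-- whenever the arguments are real numbers in the usual domain
-- (nonzero for `_⁻¹`, positive for `log` and for the base of `_^_`).

record Cut : Set₁ where
  field
    lower : ℚ → Set
    upper : ℚ → Set

open Cut public

record IsReal (x : Cut) : Set where
  field
    lower-inhabited : ∃[ q ] lower x q
    upper-inhabited : ∃[ q ] upper x q
    lower-closed    : ∀ {q r} → q < r → lower x r → lower x q
    upper-closed    : ∀ {q r} → q < r → upper x q → upper x r
    lower-open      : ∀ {q} → lower x q → ∃[ r ] (q < r × lower x r)
    upper-open      : ∀ {r} → upper x r → ∃[ q ] (q < r × upper x q)
    disjoint        : ∀ {q} → ¬ (lower x q × upper x q)
    located         : ∀ {q r} → q < r → lower x q ⊎ upper x r

infix 4 _<ᴿ_ _≤ᴿ_

_<ᴿ_ : Cut → Cut → Set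
x <ᴿ y = ∃[ q ] (upper x q × lower y q)

_≤ᴿ_ : Cut → Cut → Set
x ≤ᴿ y = ∀ q → lower x q → lower y q

fromℚ : ℚ → Cut
fromℚ p = record { lower = _< p ; upper = p <_ }

fromℕ : ℕ → Cut
fromℕ n = fromℚ (+ n / 1)

infix  9 _⁻¹
infixr 8 _^_
infixl 7 _*ᴿ_ _/ᴿ_
infixl 6 _-ᴿ_

_-ᴿ_ : Cut → Cut → Cut
x -ᴿ y = record
  { lower = λ q → ∃[ a ] ∃[ b ] (lower x a × upper y b × q < a - b)
  ; upper = λ q → ∃[ a ] ∃[ b ] (upper x a × lower y b × a - b < q)
  }

-- If a < x < b and c < y < d, then x y lies between the least and the
-- greatest of the four products of endpoints.

_*ᴿ_ : Cut → Cut → Cut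
x *ᴿ y = record
  { lower = λ q → ∃[ a ] ∃[ b ] ∃[ c ] ∃[ d ]
      (lower x a × upper x b × lower y c × upper y d ×
       q < ((a * c) ⊓ (a * d)) ⊓ ((b * c) ⊓ (b * d)))
  ; upper = λ q → ∃[ a ] ∃[ b ] ∃[ c ] ∃[ d ]
      (lower x a × upper x b × lower y c × upper y d ×
       ((a * c) ⊔ (a * d)) ⊔ ((b * c) ⊔ (b * d)) < q)
  }

-- The two summands are the cases 0 < a < x < b and a < x < b < 0.

_⁻¹ : Cut → Cut
x ⁻¹ = record
  { lower = λ q → ∃[ a ] ∃[ b ] (lower x a × upper x b ×
      (0ℚ < a × q * b < 1ℚ ⊎ b < 0ℚ × 1ℚ < q * b))
  ; upper = λ q → ∃[ a ] ∃[ b ] (lower x a × upper x b ×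
      (0ℚ < a × 1ℚ < q * a ⊎ b < 0ℚ × q * a < 1ℚ))
  }

_/ᴿ_ : Cut → Cut → Cut
x /ᴿ y = x *ᴿ y ⁻¹

------------------------------------------------------------------------
-- Exponential and natural logarithm
--
-- For rational q, the powers (1 + q/n)ⁿ with 1 + q/n > 0 increase to e^q
-- as n → ∞, strictly when q ≠ 0 (and e^0 = 1 when q = 0, where they are
-- constant).  Hence r < e^q iff r < (1 + q/n)ⁿ for some such n ≥ 1, and
-- e^q < r iff 1 < r e^(-q) iff 1 < r (1 - q/n)ⁿ for some such n ≥ 1.
-- Below n = suc k.

euler : ℚ → ℕ → ℚ
euler q k = 1ℚ + q * (+ 1 / suc k)

infix 4 _<e^_ e^_<_

_<e^_ : ℚ → ℚ → Set
r <e^ q = ∃[ k ] (0ℚ < euler q k ×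
                  r < pow +-*-rawSemiring (euler q k) (suc k))

e^_<_ : ℚ → ℚ → Set
e^ q < r = ∃[ k ] (0ℚ < euler (- q) k ×
                   1ℚ < r * pow +-*-rawSemiring (euler (- q) k) (suc k))

exp : Cut → Cut
exp x = record
  { lower = λ r → ∃[ q ] (lower x q × r <e^ q)
  ; upper = λ r → ∃[ q ] (upper x q × e^ q < r)
  }

-- q < log x iff e^q < x, and log x < q iff x < e^q.

log : Cut → Cut
log x = record
  { lower = λ q → ∃[ r ] (lower x r × e^ q < r)
  ; upper = λ q → ∃[ r ] (upper x r × r <e^ q)
  }

_^_ : Cut → Cut → Cut
x ^ y = exp (y *ᴿ log x)

{-# OPTIONS --safe #-}
-- Write s₂, s₃ for the digit sums.  Among the multiples n = 3ᵐ n′ of 3ᵐ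
-- with n < N = 4ᴸ and n′ < 3ᴸ, both s₂ (n) and s₃ (n) = s₃ (n′) have mean
-- about L, and a second moment estimate puts s₂ (n) − s₃ (n) within
-- W = O(√L) of its mean for at least half of them.  The difference is
-- then corrected exactly: by the Chinese remainder theorem the low
-- digits of n can be prescribed independently in both bases, so that
-- adding suitable small e to n changes s₂ − s₃ by any prescribed amount
-- in an interval of length W.  Here e is a sum of numbers 2ᵃ3ᵇ acting on
-- disjoint blocks of digits, each able to change the difference by a
-- prescribed power of 2.  The blocks grow by a factor less than 4 when W
-- doubles, so they occupy o(W²) = o(L) digits, which costs a factor
-- N^o(1) in the number of n.  The count is 3ᴸ N^(−o(1)), and
-- 3ᴸ = N^(log 3 / log 4).
--
-- For the real statement only powers and the inequality
-- (1 + p/k)ᵏ (1 − p/l)ˡ ≤ 1, which separates the rational lower and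
-- upper bounds of e^p, are needed.
module Submission where

-- For random n < 4ᴸ the digit sum s₂ is near L but s₃ is near L log 4 / log 3, and this gap, linear
-- in L, is out of reach of fluctuations of order √L. Prescribing about L (log 4 / log 3 - 1) low
-- ternary digits closes it and leaves about 3ᴸ integers: this is the origin of the exponent. The
-- integers used are x + u 2ᵃ 3ᵇ with u < 3ᴸ, whose low digits are those of `x₁` in base 2 and of
-- `x₂` in base 3. As the means must agree within the window W, the digit sums of `x₁` and `x₂`
-- enter the equation `balance` exactly. It determines the number of free binary digits, which in
-- turn determines b. The free digits belong to arithmetic progressions, where low and high digits
-- are not independent. Their second moments are bounded separately, which costs only constant
-- factors, absorbed by W. Corrections rest on carries: if g sets off a carry through r maximal
-- digits, its addition changes the digit sum by s (g) - (q - 1) r. The unknown values s₂ (3ᵇ) and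
-- s₃ (2ᵃ) therefore do no harm, since r can be chosen to compensate them.

module Counting where

  open import Defs using (digitSum; collisions)
  open import Data.Digit using (Expansion; fromDigits; toDigits)
  open import Data.Empty using (⊥-elim)
  open import Data.Fin.Base using (toℕ; fromℕ<)
  open import Data.Fin.Properties using (toℕ-fromℕ<; toℕ<n)
  open import Data.Integer.Base as ℤ using (ℤ; ∣_∣)
  import Data.Integer.Properties as ℤ
  import Data.Integer.Tactic.RingSolver as ℤ-Solver
  open import Data.List.Base using ([]; _∷_; [_]; _++_; _∷ʳ_; length; map; filter; upTo)
  open import Data.List.Properties using (applyUpTo-∷ʳ; filter-++; filter-accept; filter-reject; length-++; length-filter; length-upTo)
  open import Data.Nat.Base
  open import Data.Nat.Coprimality using (Coprime; coprime?; coprime-divisor; coprime-Bézout) renaming (sym to coprime-sym)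
  open import Data.Nat.Divisibility using (_∣_; divides; ∣⇒≤; ∣-trans; ∣1⇒≡1)
  open import Data.Nat.DivMod
  open import Data.Nat.GCD using (module Bézout)
  open import Data.Nat.ListAction using (sum)
  open import Data.Nat.Properties
  open import Data.Nat.Tactic.RingSolver using (solve-∀)
  open import Data.Product.Base using (_×_; _,_; proj₁; proj₂; ∃-syntax)
  open import Data.Sum.Base using (inj₁; inj₂)
  open import Function.Base using (id)
  open import Relation.Binary.PropositionalEquality
    using (_≡_; _≢_; refl; sym; trans; cong; cong₂; subst; subst₂; ≢-sym; module ≡-Reasoning)
  open import Relation.Nullary.Decidable using (Dec; True; toWitness; yes; no; from-yes)

  -- Digit sums, blocks of digits and carries

  b+c*d<a*d : ∀ {a b c d} → b < d → c < a → b + c * d < a * d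
  b+c*d<a*d {a} {b} {c} {d} b<d c<a = ≤-trans (+-monoˡ-≤ (c * d) b<d) (*-monoˡ-≤ d c<a)

  module DigitSum (q : ℕ) {q≥2 : True (2 ≤? q)} where

    1<q : 1 < q
    1<q = toWitness q≥2

    instance
      q≢0 : NonZero q
      q≢0 = >-nonZero (<-trans z<s 1<q)

    opaque
      s : ℕ → ℕ
      s = digitSum q {q≥2}

    private
      total : Expansion q → ℕ
      total ds = sum (map toℕ ds)

      uncons : ∀ {c d m n} → c < q → d < q → c + m * q ≡ d + n * q → c ≡ d × m ≡ n
      uncons {c} {d} {m} {n} c<q d<q eq = c≡d , *-cancelʳ-≡ m n q (+-cancelˡ-≡ c _ _ (trans eq (cong (_+ n * q) (sym c≡d))))
        where
        residue : ∀ {c} m → c < q → (c + m * q) % q ≡ c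
        residue {c} m c<q = trans ([m+kn]%n≡m%n c m q) (m<n⇒m%n≡m c<q)
        c≡d : c ≡ d
        c≡d = trans (sym (residue m c<q)) (trans (cong (_% q) eq) (residue n d<q))

      total-zero : ∀ (ds : Expansion q) → fromDigits ds ≡ 0 → total ds ≡ 0
      total-zero []       _  = refl
      total-zero (d ∷ ds) eq = cong₂ _+_ (m+n≡0⇒m≡0 (toℕ d) eq)
        (total-zero ds (m*n≡0⇒m≡0 (fromDigits ds) q (m+n≡0⇒n≡0 (toℕ d) eq)))

      -- Two expansions of one number differ only in leading zeros, so the digit sum may be read off
      -- from any expansion and not only from the output of `toDigits`.
      total-unique : ∀ (ds es : Expansion q) → fromDigits ds ≡ fromDigits es → total ds ≡ total es
      total-unique []         es       eq = sym (total-zero es (sym eq))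
      total-unique ds@(_ ∷ _) []       eq = total-zero ds eq
      total-unique (d ∷ ds)   (e ∷ es) eq
        with uncons {m = fromDigits ds} {fromDigits es} (toℕ<n d) (toℕ<n e) eq
      ... | d≡e , eq′ = cong₂ _+_ d≡e (total-unique ds es eq′)

      digits : ℕ → Expansion q
      digits n = proj₁ (toDigits q {q≥2} n)

      opaque
        unfolding s

        s-digits : ∀ n → s n ≡ total (digits n)
        s-digits n = refl

      s-total : ∀ ds → s (fromDigits ds) ≡ total ds
      s-total ds = trans (s-digits (fromDigits ds)) (total-unique (digits (fromDigits ds)) ds (proj₂ (toDigits q (fromDigits ds))))

    opaque
      unfolding s

      s≡digitSum : ∀ n → s n ≡ digitSum q {q≥2} n
      s≡digitSum n = refl

    s-zero : s 0 ≡ 0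
    s-zero = s-total []

    s-cons : ∀ {c} n → c < q → s (c + n * q) ≡ c + s n
    s-cons {c} n c<q = begin
      s (c + n * q)                     ≡⟨ cong₂ (λ x m → s (x + m * q)) (toℕ-fromℕ< c<q) (proj₂ (toDigits q {q≥2} n)) ⟨
      s (fromDigits (fromℕ< c<q ∷ digits n))  ≡⟨ s-total (fromℕ< c<q ∷ digits n) ⟩
      toℕ (fromℕ< c<q) + total (digits n)     ≡⟨ cong₂ _+_ (toℕ-fromℕ< c<q) (sym (s-digits n)) ⟩
      c + s n                                 ∎
      where open ≡-Reasoning

    s-digit : ∀ {c} → c < q → s c ≡ c
    s-digit {c} c<q = begin
      s c            ≡⟨ cong s (+-identityʳ c) ⟨
      s (c + 0 * q)  ≡⟨ s-cons 0 c<q ⟩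
      c + s 0        ≡⟨ cong (c +_) s-zero ⟩
      c + 0          ≡⟨ +-identityʳ c ⟩
      c              ∎
      where open ≡-Reasoning

    private
      r/q<q^k : ∀ {r} k → r < q ^ suc k → r / q < q ^ k
      r/q<q^k {r} k r<q = m<n*o⇒m/o<n (subst (r <_) (*-comm q (q ^ k)) r<q)

    s-block : ∀ k {r} n → r < q ^ k → s (r + n * q ^ k) ≡ s r + s n
    s-block zero {zero} n _ = trans (cong s (*-identityʳ n)) (cong (_+ s n) (sym s-zero))
    s-block zero {suc r} n (s≤s ())
    s-block (suc k) {r} n r<q = begin
      s (r + n * (q * q ^ k))                      ≡⟨ cong s (trans (cong (_+ n * (q * q ^ k)) (m≡m%n+[m/n]*n r q)) (regroup (r % q) (r / q) n q (q ^ k))) ⟩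
      s (r % q + (r / q + n * q ^ k) * q)          ≡⟨ s-cons _ (m%n<n r q) ⟩
      r % q + s (r / q + n * q ^ k)                ≡⟨ cong (r % q +_) (s-block k n (r/q<q^k k r<q)) ⟩
      r % q + (s (r / q) + s n)                    ≡⟨ +-assoc (r % q) _ _ ⟨
      r % q + s (r / q) + s n                      ≡⟨ cong (_+ s n) (s-cons (r / q) (m%n<n r q)) ⟨
      s (r % q + r / q * q) + s n                  ≡⟨ cong (λ z → s z + s n) (m≡m%n+[m/n]*n r q) ⟨
      s r + s n                                    ∎
      where
      open ≡-Reasoning
      regroup : ∀ c d n q p → c + d * q + n * (q * p) ≡ c + (d + n * p) * q
      regroup = solve-∀

    s-bound : ∀ k {r} → r < q ^ k → s r ≤ pred q * k
    s-bound zero {zero} _ = ≤-trans (≤-reflexive s-zero) z≤n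
    s-bound zero {suc r} (s≤s ())
    s-bound (suc k) {r} r<q = begin
      s r                    ≡⟨ cong s (m≡m%n+[m/n]*n r q) ⟩
      s (r % q + r / q * q)  ≡⟨ s-cons (r / q) (m%n<n r q) ⟩
      r % q + s (r / q)      ≤⟨ +-mono-≤ (<⇒≤pred (m%n<n r q)) (s-bound k (r/q<q^k k r<q)) ⟩
      pred q + pred q * k    ≡⟨ *-suc (pred q) k ⟨
      pred q * suc k         ∎
      where open ≤-Reasoning

    -- In base q this is written with r digits, all equal to q - 1 and not to 1, so that adding 1
    -- carries through all of them.
    repunit : ℕ → ℕ
    repunit r = pred (q ^ r)

    s-repunit : ∀ r → s (repunit r) ≡ pred q * r
    s-repunit zero = trans s-zero (sym (*-zeroʳ (pred q)))
    s-repunit (suc r) = begin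
      s (pred (q * q ^ r))            ≡⟨ cong (λ z → s (pred (q * z))) (suc-pred (q ^ r) {{m^n≢0 q r}}) ⟨
      s (pred (q * suc (repunit r)))  ≡⟨ cong (λ z → s (pred (z * suc (repunit r)))) (suc-pred q) ⟨
      s (repunit r + pred q * suc (repunit r))  ≡⟨ cong s (trans (regroup (repunit r) (pred q)) (cong (λ z → pred q + repunit r * z) (suc-pred q))) ⟩
      s (pred q + repunit r * q)      ≡⟨ s-cons (repunit r) (≤-reflexive (suc-pred q)) ⟩
      pred q + s (repunit r)          ≡⟨ cong (pred q +_) (s-repunit r) ⟩
      pred q + pred q * r             ≡⟨ *-suc (pred q) r ⟨
      pred q * suc r                  ∎
      where
      open ≡-Reasoning
      regroup : ∀ t p → t + p * suc t ≡ p + t * suc p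
      regroup = solve-∀

    -- Adding g to r maximal digits placed on the top digit of g
    -- propagates a carry through all of them.
    carry : ∀ {v g} r → q ^ v ≤ g → g < q ^ suc v →
            ∃[ y ] (s y ≡ pred q * r × s (y + g) ≡ s g × y + g < q ^ (v + suc r))
    carry {v} {g} zero q^v≤g g<q^1+v = 0 , trans s-zero (sym (*-zeroʳ (pred q))) , refl ,
      subst (λ z → g < q ^ z) (sym (+-comm v 1)) g<q^1+v
    carry {v} {g} (suc r) q^v≤g g<q^1+v = y , sy , sy+g , y+g<
      where
      module E = ≡-Reasoning
      instance
        q^v≢0 : NonZero (q ^ v)
        q^v≢0 = m^n≢0 q v
      Q c g₀ y : ℕ
      Q = q ^ suc r
      c = g / q ^ v
      g₀ = g % q ^ v
      y = repunit (suc r) * q ^ v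
      g₀<  : g₀ < q ^ v
      g₀< = m%n<n g (q ^ v)
      c<q : c < q
      c<q = m<n*o⇒m/o<n g<q^1+v
      1≤c : 1 ≤ c
      1≤c = m≥n⇒m/n>0 q^v≤g
      c≡ : suc (pred c) ≡ c
      c≡ = suc-pred c {{>-nonZero 1≤c}}
      q≤Q : q ≤ Q
      q≤Q = m≤m*n q (q ^ r) {{m^n≢0 q r}}
      c-1<q : pred c < q
      c-1<q = ≤-<-trans pred[n]≤n c<q
      -- c + (Q - 1) = (c - 1) + Q: the leading digit c of g leaves c - 1 in its place and the
      -- missing unit reappears just above the maximal digits, so the digit sum of g survives.
      y+g≡ : y + g ≡ g₀ + (pred c + 1 * Q) * q ^ v
      y+g≡ = E.begin
        pred Q * q ^ v + g                          E.≡⟨ cong (pred Q * q ^ v +_) (m≡m%n+[m/n]*n g (q ^ v)) ⟩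
        pred Q * q ^ v + (g₀ + c * q ^ v)           E.≡⟨ cong (λ z → pred Q * q ^ v + (g₀ + z * q ^ v)) c≡ ⟨
        pred Q * q ^ v + (g₀ + suc (pred c) * q ^ v) E.≡⟨ regroup (pred Q) (q ^ v) g₀ (pred c) ⟩
        g₀ + (pred c + 1 * suc (pred Q)) * q ^ v    E.≡⟨ cong (λ z → g₀ + (pred c + 1 * z) * q ^ v) (suc-pred Q {{m^n≢0 q (suc r)}}) ⟩
        g₀ + (pred c + 1 * Q) * q ^ v               E.∎
        where
        regroup : ∀ Q p g c → Q * p + (g + suc c * p) ≡ g + (c + 1 * suc Q) * p
        regroup = solve-∀
      sy : s y ≡ pred q * suc r
      sy = E.begin
        s (0 + y)                    E.≡⟨ s-block v (repunit (suc r)) (m^n>0 q v) ⟩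
        s 0 + s (repunit (suc r))    E.≡⟨ cong₂ _+_ s-zero (s-repunit (suc r)) ⟩
        pred q * suc r               E.∎
      sy+g : s (y + g) ≡ s g
      sy+g = E.begin
        s (y + g)                               E.≡⟨ cong s y+g≡ ⟩
        s (g₀ + (pred c + 1 * Q) * q ^ v)       E.≡⟨ s-block v _ g₀< ⟩
        s g₀ + s (pred c + 1 * Q)               E.≡⟨ cong (s g₀ +_) (s-block (suc r) 1 (<-≤-trans c-1<q q≤Q)) ⟩
        s g₀ + (s (pred c) + s 1)               E.≡⟨ cong₂ (λ a b → s g₀ + (a + b)) (s-digit c-1<q) (s-digit 1<q) ⟩
        s g₀ + (pred c + 1)                     E.≡⟨ cong (s g₀ +_) (trans (+-comm _ 1) c≡) ⟩
        s g₀ + c                                E.≡⟨ cong (s g₀ +_) (s-digit c<q) ⟨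
        s g₀ + s c                              E.≡⟨ s-block v c g₀< ⟨
        s (g₀ + c * q ^ v)                      E.≡⟨ cong s (m≡m%n+[m/n]*n g (q ^ v)) ⟨
        s g                                     E.∎
      y+g< : y + g < q ^ (v + suc (suc r))
      y+g< = begin-strict
        y + g                            ≡⟨ y+g≡ ⟩
        g₀ + (pred c + 1 * Q) * q ^ v    <⟨ b+c*d<a*d g₀< (begin-strict
          pred c + 1 * Q                   <⟨ +-mono-<-≤ (<-≤-trans c-1<q q≤Q) ≤-refl ⟩
          Q + 1 * Q                        ≡⟨⟩
          2 * Q                            ≤⟨ *-monoˡ-≤ Q 1<q ⟩
          q * Q                            ∎) ⟩
        q * Q * q ^ v                    ≡⟨ *-comm (q * Q) (q ^ v) ⟩
        q ^ v * (q * Q)                  ≡⟨ ^-distribˡ-+-* q v (suc (suc r)) ⟨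
        q ^ (v + suc (suc r))            ∎
        where open ≤-Reasoning

  module Two = DigitSum 2
  module Three = DigitSum 3
  open Two using () renaming (s to s₂)
  open Three using () renaming (s to s₃)
  open Two using () renaming (s to s₂)
  open Three using () renaming (s to s₃)

  -- Prescribed changes of s₂ - s₃ by carries

  ^-cancelʳ-< : ∀ q {m n} → .{{NonZero q}} → q ^ m < q ^ n → m < n
  ^-cancelʳ-< q {m} {n} q^m<q^n = ≰⇒> (λ n≤m → <⇒≱ q^m<q^n (^-monoʳ-≤ q n≤m))

  floorLog : ∀ {q n} → 1 < q → 1 ≤ n → ∃[ v ] (q ^ v ≤ n × n < q ^ suc v)
  floorLog {q} {suc zero} 1<q _ = 0 , ≤-refl , subst (1 <_) (sym (*-identityʳ q)) 1<q
  floorLog {q} {suc n@(suc _)} 1<q _ with floorLog {q} {n} 1<q (s≤s z≤n)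
  ... | v , q^v≤n , n<q^1+v with suc n <? q ^ suc v
  ...   | yes 1+n<q^1+v = v , m≤n⇒m≤1+n q^v≤n , 1+n<q^1+v
  ...   | no 1+n≮q^1+v = suc v , ≮⇒≥ 1+n≮q^1+v ,
          ≤-<-trans n<q^1+v (^-monoʳ-< q 1<q (n<1+n (suc v)))

  double-^ : ∀ m n → m ^ (2 * n) ≡ (m * m) ^ n
  double-^ m n = trans (sym (^-*-assoc m 2 n)) (cong (λ z → (m * z) ^ n) (*-identityʳ m))

  half : ∀ m → ∃[ r ] ∃[ p ] (p ≤ 1 × 2 * r ≡ m + p)
  half zero = 0 , 0 , z≤n , refl
  half (suc zero) = 1 , 1 , ≤-refl , refl
  half (suc (suc m)) with half m
  ... | r , p , p≤1 , eq = suc r , p , p≤1 , trans (*-suc 2 r) (cong (2 +_) eq)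

  -- The two carry lengths are chosen so that the discrepancy between
  -- s₂ (3 ^ b) and s₃ (2 ^ a) is replaced by W.
  discrepancy : ∀ a b W → ∃[ y ] ∃[ z ]
    (s₂ (y + 3 ^ b) + s₃ z ≡ s₃ (z + 2 ^ a) + s₂ y + W ×
     y + 3 ^ b < 2 ^ (4 * b + 2) × z + 2 ^ a < 3 ^ (2 * a + W + 2))
  discrepancy a b W
    with v , 2^v≤g , g<2^1+v ← floorLog {2} {3 ^ b} (s≤s (s≤s z≤n)) (m^n>0 3 b)
       | w , 3^w≤h , h<3^1+w ← floorLog {3} {2 ^ a} (s≤s (s≤s z≤n)) (m^n>0 2 a)
    = choose (≤-total (t + W) σ)
    where
    σ t : ℕ
    σ = s₂ (3 ^ b)
    t = s₃ (2 ^ a)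

    v≤2b : v ≤ 2 * b
    v≤2b = s≤s⁻¹ (^-cancelʳ-< 2 (begin-strict
      2 ^ v            ≤⟨ 2^v≤g ⟩
      3 ^ b            ≤⟨ ^-monoˡ-≤ b (s≤s (s≤s (s≤s z≤n))) ⟩
      4 ^ b            ≡⟨ double-^ 2 b ⟨
      2 ^ (2 * b)      <⟨ ^-monoʳ-< 2 (s≤s (s≤s z≤n)) (n<1+n (2 * b)) ⟩
      2 ^ suc (2 * b)  ∎))
      where open ≤-Reasoning

    w≤a : w ≤ a
    w≤a = s≤s⁻¹ (^-cancelʳ-< 3 (begin-strict
      3 ^ w      ≤⟨ 3^w≤h ⟩
      2 ^ a      ≤⟨ ^-monoˡ-≤ a (s≤s (s≤s z≤n)) ⟩
      3 ^ a      <⟨ ^-monoʳ-< 3 (s≤s (s≤s z≤n)) (n<1+n a) ⟩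
      3 ^ suc a  ∎))
      where open ≤-Reasoning

    σ≤ : σ ≤ suc (2 * b)
    σ≤ = ≤-trans (Two.s-bound (suc v) g<2^1+v) (≤-trans (≤-reflexive (*-identityˡ (suc v))) (s≤s v≤2b))

    t≤ : t ≤ 2 * suc a
    t≤ = ≤-trans (Three.s-bound (suc w) h<3^1+w) (*-monoʳ-≤ 2 (s≤s w≤a))

    -- With carry lengths r in base 2 and r′ in base 3, adding 3 ^ b changes s₂ by σ - r and adding
    -- 2 ^ a changes s₃ by t - 2 r′; the equation asks that these changes differ by W.
    build : ∀ r r′ → σ + 2 * r′ ≡ t + r + W → v + suc r ≤ 4 * b + 2 → w + suc r′ ≤ 2 * a + W + 2 →
      ∃[ y ] ∃[ z ]
        (s₂ (y + 3 ^ b) + s₃ z ≡ s₃ (z + 2 ^ a) + s₂ y + W ×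
         y + 3 ^ b < 2 ^ (4 * b + 2) × z + 2 ^ a < 3 ^ (2 * a + W + 2))
    build r r′ eq v≤ w≤
      with y , sy , sy+g , y< ← Two.carry {v = v} r 2^v≤g g<2^1+v
         | z , sz , sz+h , z< ← Three.carry {v = w} r′ 3^w≤h h<3^1+w
      = y , z
      , trans (cong₂ _+_ sy+g sz) (trans eq (cong (_+ W) (cong₂ _+_ (sym sz+h) (trans (sym (*-identityˡ r)) (sym sy)))))
      , <-≤-trans y< (^-monoʳ-≤ 2 v≤)
      , <-≤-trans z< (^-monoʳ-≤ 3 w≤)

    choose : _ → _
    -- A binary carry alone suffices: each of its digits removes one unit of the surplus σ - (t +
    -- W).
    choose (inj₁ t+W≤σ) = build r 0 eq v≤ w≤
      where
      open ≤-Reasoning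
      r : ℕ
      r = σ ∸ (t + W)
      eq : σ + 0 ≡ t + r + W
      eq = trans (+-identityʳ σ) (trans (sym (m+[n∸m]≡n t+W≤σ)) (swap t W r))
        where
        swap : ∀ t W r → t + W + r ≡ t + r + W
        swap = solve-∀
      v≤ : v + suc r ≤ 4 * b + 2
      v≤ = begin
        v + suc r                    ≤⟨ +-mono-≤ v≤2b (s≤s (≤-trans (m∸n≤m σ (t + W)) σ≤)) ⟩
        2 * b + suc (suc (2 * b))    ≡⟨ ring b ⟩
        4 * b + 2                    ∎
        where
        ring : ∀ b → 2 * b + suc (suc (2 * b)) ≡ 4 * b + 2
        ring = solve-∀
      w≤ : w + 1 ≤ 2 * a + W + 2
      w≤ = +-mono-≤ (≤-trans w≤a (≤-trans (m≤m+n a (a + 0)) (m≤m+n (2 * a) W))) (s≤s z≤n)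
    -- A ternary carry gains 2 per digit, so its length is half the deficit rounded up, and a binary
    -- carry of length at most 1 repairs the parity.
    choose (inj₂ σ≤t+W) with half (t + W ∸ σ)
    ... | r′ , r , r≤1 , eq₀ = build r r′ eq v≤ w≤
      where
      open ≤-Reasoning
      eq : σ + 2 * r′ ≡ t + r + W
      eq = begin-equality
        σ + 2 * r′            ≡⟨ cong (σ +_) eq₀ ⟩
        σ + (t + W ∸ σ + r)   ≡⟨ +-assoc σ _ r ⟨
        σ + (t + W ∸ σ) + r   ≡⟨ cong (_+ r) (m+[n∸m]≡n σ≤t+W) ⟩
        t + W + r             ≡⟨ swap t W r ⟩
        t + r + W             ∎
        where
        swap : ∀ t W r → t + W + r ≡ t + r + W
        swap = solve-∀
      r′≤ : r′ ≤ a + 1 + W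
      r′≤ = s≤s⁻¹ (*-cancelˡ-< 2 r′ _ (begin-strict
        2 * r′                  ≡⟨ eq₀ ⟩
        t + W ∸ σ + r           ≤⟨ +-mono-≤ (m∸n≤m (t + W) σ) r≤1 ⟩
        t + W + 1               ≤⟨ +-monoˡ-≤ 1 (+-monoˡ-≤ W t≤) ⟩
        2 * suc a + W + 1       <⟨ m≤m+n _ W ⟩
        suc (2 * suc a + W + 1) + W  ≡⟨ ring a W ⟩
        2 * suc (a + 1 + W)     ∎))
        where
        ring : ∀ a W → suc (2 * suc a + W + 1) + W ≡ 2 * suc (a + 1 + W)
        ring = solve-∀
      v≤ : v + suc r ≤ 4 * b + 2
      v≤ = +-mono-≤ (≤-trans v≤2b (*-monoˡ-≤ b {2} {4} (s≤s (s≤s z≤n)))) (s≤s r≤1)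
      w≤ : w + suc r′ ≤ 2 * a + W + 2
      w≤ = begin
        w + suc r′              ≤⟨ +-mono-≤ w≤a (s≤s r′≤) ⟩
        a + suc (a + 1 + W)     ≡⟨ ring a W ⟩
        2 * a + W + 2           ∎
        where
        ring : ∀ a W → a + suc (a + 1 + W) ≡ 2 * a + W + 2
        ring = solve-∀

  -- x₁ and x₂ prescribe the low digits, in bases 2 and 3, of integers n
  -- for which s₂ (n + e) − s₃ (n + e), as e varies, runs through W
  -- consecutive integers starting at its value for e = 0.
  record Adjuster (a b W : ℕ) : Set where
    field
      x₁ x₂  : ℕ
      adjust : ∀ D → D < W → ∃[ e ]
        (x₁ + e < 2 ^ a × x₂ + e < 3 ^ b ×
         s₂ (x₁ + e) + s₃ x₂ ≡ s₃ (x₂ + e) + s₂ x₁ + D)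

  adjuster-1 : Adjuster 0 0 1
  adjuster-1 = record { x₁ = 0 ; x₂ = 0 ; adjust = λ { zero _ → 0 , ≤-refl , ≤-refl , trans (+-comm (s₂ 0) (s₃ 0)) (sym (+-identityʳ _)) ; (suc _) (s≤s ()) } }

  -- Above the digits taken by the given adjuster, the number 2 ^ a * 3 ^ b acts as 3 ^ b in base 2
  -- and as 2 ^ a in base 3. The upper blocks y and z come from `discrepancy`, so that adding it
  -- raises s₂ - s₃ by exactly W; for D ≥ W it is added to the old correction for D - W.
  adjuster-double : ∀ {a b W} → 0 < W → Adjuster a b W → Adjuster (a + (4 * b + 2)) (b + (2 * a + W + 2)) (2 * W)
  adjuster-double {a} {b} {W} 0<W A
    with y , z , gap , y< , z< ← discrepancy a b W
    = record { x₁ = x₁ + y * 2 ^ a ; x₂ = x₂ + z * 3 ^ b ; adjust = adjust′ }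
    where
    open Adjuster A

    x₁< : x₁ < 2 ^ a
    x₁< = ≤-<-trans (m≤m+n x₁ _) (proj₁ (proj₂ (adjust 0 0<W)))
    x₂< : x₂ < 3 ^ b
    x₂< = ≤-<-trans (m≤m+n x₂ _) (proj₁ (proj₂ (proj₂ (adjust 0 0<W))))

    fits : ∀ q k l {c d} → c < q ^ k → d < q ^ l → c + d * q ^ k < q ^ (k + l)
    fits q k l {c} {d} c< d< = subst (c + d * q ^ k <_)
      (trans (*-comm (q ^ l) (q ^ k)) (sym (^-distribˡ-+-* q k l))) (b+c*d<a*d c< d<)

    adjust′ : ∀ D → D < 2 * W → ∃[ e ]
      (x₁ + y * 2 ^ a + e < 2 ^ (a + (4 * b + 2)) × x₂ + z * 3 ^ b + e < 3 ^ (b + (2 * a + W + 2)) ×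
       s₂ (x₁ + y * 2 ^ a + e) + s₃ (x₂ + z * 3 ^ b) ≡ s₃ (x₂ + z * 3 ^ b + e) + s₂ (x₁ + y * 2 ^ a) + D)
    adjust′ D D<2W with D <? W
    ... | yes D<W with e , e₁ , e₂ , eq ← adjust D D<W = e
      , subst (_< 2 ^ (a + (4 * b + 2))) (sym (move x₁ (y * 2 ^ a) e)) (fits 2 a (4 * b + 2) e₁ (≤-<-trans (m≤m+n y _) y<))
      , subst (_< 3 ^ (b + (2 * a + W + 2))) (sym (move x₂ (z * 3 ^ b) e)) (fits 3 b (2 * a + W + 2) e₂ (≤-<-trans (m≤m+n z _) z<))
      , (begin
        s₂ (x₁ + y * 2 ^ a + e) + s₃ (x₂ + z * 3 ^ b)     ≡⟨ cong₂ _+_ (trans (cong s₂ (move x₁ _ e)) (Two.s-block a y e₁)) (Three.s-block b z x₂<) ⟩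
        s₂ (x₁ + e) + s₂ y + (s₃ x₂ + s₃ z)               ≡⟨ interchange (s₂ (x₁ + e)) (s₂ y) (s₃ x₂) (s₃ z) ⟩
        s₂ (x₁ + e) + s₃ x₂ + (s₂ y + s₃ z)               ≡⟨ cong (_+ (s₂ y + s₃ z)) eq ⟩
        s₃ (x₂ + e) + s₂ x₁ + D + (s₂ y + s₃ z)           ≡⟨ regroup (s₃ (x₂ + e)) (s₂ x₁) D (s₂ y) (s₃ z) ⟩
        s₃ (x₂ + e) + s₃ z + (s₂ x₁ + s₂ y) + D           ≡⟨ cong₂ (λ α β → α + β + D) (trans (cong s₃ (move x₂ _ e)) (Three.s-block b z e₂)) (Two.s-block a y x₁<) ⟨
        s₃ (x₂ + z * 3 ^ b + e) + s₂ (x₁ + y * 2 ^ a) + D ∎)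
      where
      open ≡-Reasoning
      move : ∀ x p e → x + p + e ≡ x + e + p
      move = solve-∀
      interchange : ∀ α β γ δ → α + β + (γ + δ) ≡ α + γ + (β + δ)
      interchange = solve-∀
      regroup : ∀ α β D γ δ → α + β + D + (γ + δ) ≡ α + δ + (β + γ) + D
      regroup = solve-∀
    ... | no D≮W with e , e₁ , e₂ , eq ← adjust (D ∸ W) (+-cancelˡ-< W _ _ (≤-<-trans (≤-reflexive (m+[n∸m]≡n (≮⇒≥ D≮W))) (<-≤-trans D<2W (≤-reflexive (cong (W +_) (+-identityʳ W))))))
      = e + 3 ^ b * 2 ^ a
      , subst (_< 2 ^ (a + (4 * b + 2))) (sym m₁) (fits 2 a (4 * b + 2) e₁ y<)
      , subst (_< 3 ^ (b + (2 * a + W + 2))) (sym m₂) (fits 3 b (2 * a + W + 2) e₂ z<)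
      , (begin
        s₂ (x₁ + y * 2 ^ a + (e + 3 ^ b * 2 ^ a)) + s₃ (x₂ + z * 3 ^ b) ≡⟨ cong₂ _+_ (trans (cong s₂ m₁) (Two.s-block a (y + 3 ^ b) e₁)) (Three.s-block b z x₂<) ⟩
        s₂ (x₁ + e) + s₂ (y + 3 ^ b) + (s₃ x₂ + s₃ z)     ≡⟨ interchange (s₂ (x₁ + e)) (s₂ (y + 3 ^ b)) (s₃ x₂) (s₃ z) ⟩
        s₂ (x₁ + e) + s₃ x₂ + (s₂ (y + 3 ^ b) + s₃ z)     ≡⟨ cong₂ _+_ eq gap ⟩
        s₃ (x₂ + e) + s₂ x₁ + (D ∸ W) + (s₃ (z + 2 ^ a) + s₂ y + W) ≡⟨ regroup (s₃ (x₂ + e)) (s₂ x₁) (D ∸ W) (s₂ y) (s₃ (z + 2 ^ a)) W ⟩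
        s₃ (x₂ + e) + s₃ (z + 2 ^ a) + (s₂ x₁ + s₂ y) + (W + (D ∸ W)) ≡⟨ cong₂ _+_ (cong₂ _+_ (trans (cong s₃ m₂) (Three.s-block b (z + 2 ^ a) e₂)) (Two.s-block a y x₁<)) (sym (m+[n∸m]≡n (≮⇒≥ D≮W))) ⟨
        s₃ (x₂ + z * 3 ^ b + (e + 3 ^ b * 2 ^ a)) + s₂ (x₁ + y * 2 ^ a) + D ∎)
      where
      open ≡-Reasoning
      move₁ : ∀ x y p e g → x + y * p + (e + g * p) ≡ x + e + (y + g) * p
      move₁ = solve-∀
      move₂ : ∀ x z p e h → x + z * p + (e + p * h) ≡ x + e + (z + h) * p
      move₂ = solve-∀
      m₁ : x₁ + y * 2 ^ a + (e + 3 ^ b * 2 ^ a) ≡ x₁ + e + (y + 3 ^ b) * 2 ^ a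
      m₁ = move₁ x₁ y (2 ^ a) e (3 ^ b)
      m₂ : x₂ + z * 3 ^ b + (e + 3 ^ b * 2 ^ a) ≡ x₂ + e + (z + 2 ^ a) * 3 ^ b
      m₂ = move₂ x₂ z (3 ^ b) e (2 ^ a)
      interchange : ∀ α β γ δ → α + β + (γ + δ) ≡ α + γ + (β + δ)
      interchange = solve-∀
      regroup : ∀ α β D γ δ W → α + β + D + (δ + γ + W) ≡ α + δ + (β + γ) + (W + D)
      regroup = solve-∀

  -- The growth rate 27/7 is less than 4, so the size of an adjuster of
  -- range W = 2 ^ w is o(W ²); the weights 5, 7 are close to the
  -- eigenvector of the recursion for (a, b).
  size : ℕ → ℕ → ℕ → ℕ
  size a b W = 5 * a + 7 * b + 4 * W + 9

  -- The recursion for (a, b) has the eigenvalue 1 + 2√2 ≈ 3.83, just below 27/7. The weights 4 and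
  -- 9 in `size` absorb the terms in W and the constants, and 13 is `size 0 0 1`.
  adjuster : ∀ w → ∃[ a ] ∃[ b ] (Adjuster a b (2 ^ w) × 7 ^ w * size a b (2 ^ w) ≤ 13 * 27 ^ w)
  adjuster zero = 0 , 0 , adjuster-1 , ≤-refl
  adjuster (suc w) with a , b , A , bound ← adjuster w
    = a + (4 * b + 2) , b + (2 * a + 2 ^ w + 2) , adjuster-double (m^n>0 2 w) A , (begin
      7 ^ suc w * size (a + (4 * b + 2)) (b + (2 * a + W + 2)) (2 * W)    ≡⟨ *-assoc-comm 7 (7 ^ w) (size (a + (4 * b + 2)) (b + (2 * a + W + 2)) (2 * W)) ⟩
      7 ^ w * (7 * size (a + (4 * b + 2)) (b + (2 * a + W + 2)) (2 * W))  ≤⟨ *-monoʳ-≤ (7 ^ w) (growth a b W) ⟩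
      7 ^ w * (27 * size a b W)    ≡⟨ swap (7 ^ w) 27 (size a b W) ⟩
      27 * (7 ^ w * size a b W)    ≤⟨ *-monoʳ-≤ 27 bound ⟩
      27 * (13 * 27 ^ w)           ≡⟨ swap 27 13 (27 ^ w) ⟩
      13 * 27 ^ suc w              ∎)
    where
    open ≤-Reasoning
    W : ℕ
    W = 2 ^ w
    *-assoc-comm : ∀ x y z → x * y * z ≡ y * (x * z)
    *-assoc-comm = solve-∀
    swap : ∀ x y z → x * (y * z) ≡ y * (x * z)
    swap = solve-∀
    growth : ∀ a b W → 7 * size (a + (4 * b + 2)) (b + (2 * a + W + 2)) (2 * W) ≤ 27 * size a b W
    growth a b W = subst (7 * size (a + (4 * b + 2)) (b + (2 * a + W + 2)) (2 * W) ≤_) (slack a b W) (m≤m+n _ _)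
      where
      slack : ∀ a b W → 7 * (5 * (a + (4 * b + 2)) + 7 * (b + (2 * a + W + 2)) + 4 * (2 * W) + 9) + (2 * a + 3 * W + 12)
                      ≡ 27 * (5 * a + 7 * b + 4 * W + 9)
      slack = solve-∀

  -- Second moments of digit sums over all numbers of a given length

  module Moments where

    open import Data.Integer.Base using (+_)

    ∑ : ℕ → (ℕ → ℕ) → ℕ
    ∑ zero    f = 0
    ∑ (suc n) f = ∑ n f + f n

    ∑-cong : ∀ n {f g : ℕ → ℕ} → (∀ i → i < n → f i ≡ g i) → ∑ n f ≡ ∑ n g
    ∑-cong zero    f≡g = refl
    ∑-cong (suc n) f≡g = cong₂ _+_ (∑-cong n (λ i i<n → f≡g i (m<n⇒m<1+n i<n))) (f≡g n ≤-refl)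

    ∑-mono : ∀ n {f g : ℕ → ℕ} → (∀ i → i < n → f i ≤ g i) → ∑ n f ≤ ∑ n g
    ∑-mono zero    f≤g = z≤n
    ∑-mono (suc n) f≤g = +-mono-≤ (∑-mono n (λ i i<n → f≤g i (m<n⇒m<1+n i<n))) (f≤g n ≤-refl)

    ∑-const : ∀ n c → ∑ n (λ _ → c) ≡ n * c
    ∑-const zero    c = refl
    ∑-const (suc n) c = trans (+-comm _ c) (cong (λ x → c + x) (∑-const n c))

    ∑-distrib-+ : ∀ n (f g : ℕ → ℕ) → ∑ n (λ i → f i + g i) ≡ ∑ n f + ∑ n g
    ∑-distrib-+ zero    f g = refl
    ∑-distrib-+ (suc n) f g = trans (cong (_+ (f n + g n)) (∑-distrib-+ n f g)) (interchange (∑ n f) (∑ n g) (f n) (g n))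
      where
      interchange : ∀ a b c d → a + b + (c + d) ≡ a + c + (b + d)
      interchange = solve-∀

    *-distrib-∑ : ∀ n c (f : ℕ → ℕ) → ∑ n (λ i → c * f i) ≡ c * ∑ n f
    *-distrib-∑ zero    c f = sym (*-zeroʳ c)
    *-distrib-∑ (suc n) c f = trans (cong (_+ c * f n) (*-distrib-∑ n c f)) (sym (*-distribˡ-+ c (∑ n f) (f n)))

    ∑-split : ∀ m n (f : ℕ → ℕ) → ∑ (n + m) f ≡ ∑ m f + ∑ n (λ i → f (i + m))
    ∑-split m zero    f = sym (+-identityʳ (∑ m f))
    ∑-split m (suc n) f = trans (cong (_+ f (n + m)) (∑-split m n f)) (+-assoc (∑ m f) _ _)

    ∑-≤ : ∀ {m n} (f : ℕ → ℕ) → m ≤ n → ∑ m f ≤ ∑ n f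
    ∑-≤ {m} {n} f m≤n = subst (λ z → ∑ m f ≤ ∑ z f) (m∸n+n≡m m≤n)
      (subst (∑ m f ≤_) (sym (∑-split m (n ∸ m) f)) (m≤m+n _ _))

    ∑-blocks : ∀ a b (f : ℕ → ℕ) → ∑ (a * b) f ≡ ∑ a (λ i → ∑ b (λ c → f (c + i * b)))
    ∑-blocks zero    b f = refl
    ∑-blocks (suc a) b f = trans (∑-split (a * b) b f) (cong (_+ ∑ b (λ c → f (c + a * b))) (∑-blocks a b f))

    ∑-swap : ∀ a b (f : ℕ → ℕ → ℕ) → ∑ a (λ i → ∑ b (f i)) ≡ ∑ b (λ j → ∑ a (λ i → f i j))
    ∑-swap zero    b f = sym (trans (∑-const b 0) (*-zeroʳ b))
    ∑-swap (suc a) b f = trans (cong (_+ ∑ b (f a)) (∑-swap a b f)) (sym (∑-distrib-+ b _ (f a)))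

    private
      erase : ℕ → (ℕ → ℕ) → ℕ → ℕ
      erase v f x with x ≟ v
      ... | yes _ = 0
      ... | no  _ = f x

      erase-≢ : ∀ {v x} f → x ≢ v → erase v f x ≡ f x
      erase-≢ {v} {x} f x≢v with x ≟ v
      ... | yes x≡v = ⊥-elim (x≢v x≡v)
      ... | no  _   = refl

      ∑-erase : ∀ {v} n f → v < n → ∑ n f ≡ ∑ n (erase v f) + f v
      ∑-erase {v} (suc n) f v<1+n with n ≟ v
      ... | yes refl = cong (_+ f n) (sym (trans (+-identityʳ (∑ n (erase n f)))
                         (∑-cong n (λ i i<n → erase-≢ f (<⇒≢ i<n)))))
      ... | no n≢v = trans (cong (_+ f n) (∑-erase n f (≤∧≢⇒< (s≤s⁻¹ v<1+n) (≢-sym n≢v))))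
                       (swap (∑ n (erase v f)) (f v) (f n))
        where
        swap : ∀ a b c → a + b + c ≡ a + c + b
        swap = solve-∀

    -- Replacing f by zero at `φ P` leaves the terms before P unchanged, by injectivity, and takes
    -- exactly `f (φ P)` off the sum over V; this is the induction step.
    ∑-injective : ∀ P {V} (φ f : ℕ → ℕ) → (∀ i → i < P → φ i < V) →
                  (∀ {i j} → i < j → j < P → φ i ≢ φ j) → ∑ P (λ i → f (φ i)) ≤ ∑ V f
    ∑-injective zero        φ f φ< φ-inj = z≤n
    ∑-injective (suc P) {V} φ f φ< φ-inj = begin
      ∑ P (λ i → f (φ i)) + f (φ P)                    ≡⟨ cong (_+ f (φ P)) (∑-cong P (λ i i<P → erase-≢ f (φ-inj i<P ≤-refl))) ⟨
      ∑ P (λ i → erase (φ P) f (φ i)) + f (φ P)        ≤⟨ +-monoˡ-≤ (f (φ P)) (∑-injective P φ (erase (φ P) f)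
                                                           (λ i i<P → φ< i (m<n⇒m<1+n i<P)) (λ i<j j<P → φ-inj i<j (m<n⇒m<1+n j<P))) ⟩
      ∑ V (erase (φ P) f) + f (φ P)                    ≡⟨ ∑-erase V f (φ< P ≤-refl) ⟨
      ∑ V f                                            ∎
      where open ≤-Reasoning

    sq : ℤ → ℕ
    sq z = ∣ z ∣ * ∣ z ∣

    +sq : ∀ z → + sq z ≡ z ℤ.* z
    +sq (+ n)          = ℤ.pos-* n n
    +sq (ℤ.-[1+ n ])   = refl

    -- The parallelogram law with the square of a - b dropped.
    sq-+ : ∀ a b → sq (a ℤ.+ b) ≤ 2 * (sq a + sq b)
    sq-+ a b = subst (sq (a ℤ.+ b) ≤_) (ℤ.+-injective parallelogram) (m≤m+n _ _)
      where
      open ≡-Reasoning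
      ring : ∀ a b → (a ℤ.+ b) ℤ.* (a ℤ.+ b) ℤ.+ (a ℤ.- b) ℤ.* (a ℤ.- b) ≡ + 2 ℤ.* (a ℤ.* a ℤ.+ b ℤ.* b)
      ring = ℤ-Solver.solve-∀
      parallelogram : + (sq (a ℤ.+ b) + sq (a ℤ.- b)) ≡ + (2 * (sq a + sq b))
      parallelogram = begin
        + sq (a ℤ.+ b) ℤ.+ + sq (a ℤ.- b)                              ≡⟨ cong₂ ℤ._+_ (+sq (a ℤ.+ b)) (+sq (a ℤ.- b)) ⟩
        (a ℤ.+ b) ℤ.* (a ℤ.+ b) ℤ.+ (a ℤ.- b) ℤ.* (a ℤ.- b)            ≡⟨ ring a b ⟩
        + 2 ℤ.* (a ℤ.* a ℤ.+ b ℤ.* b)                                  ≡⟨ cong₂ (λ x y → + 2 ℤ.* (x ℤ.+ y)) (+sq a) (+sq b) ⟨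
        + 2 ℤ.* + (sq a + sq b)                                        ≡⟨ ℤ.pos-* 2 (sq a + sq b) ⟨
        + (2 * (sq a + sq b))                                          ∎

    -- The factor 2 keeps the deviation of c from the mean digit (q - 1)/2 an integer. The values
    -- are -1, 1 for q = 2 and -2, 0, 2 for q = 3. They sum to zero, so no term linear in z survives
    -- in the digit moments below, and their squares sum to 2 and 8.
    centred-digit : ℕ → ℕ → ℤ
    centred-digit q c = + 2 ℤ.* + c ℤ.- + pred q

    digit-moment₂ : ∀ z → ∑ 2 (λ c → sq (z ℤ.+ centred-digit 2 c)) ≡ 2 * sq z + 2
    digit-moment₂ z = ℤ.+-injective (begin
      + (∑ 2 (λ c → sq (z ℤ.+ centred-digit 2 c)))     ≡⟨ cong₂ ℤ._+_ (+sq (z ℤ.+ ℤ.- + 1)) (+sq (z ℤ.+ + 1)) ⟩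
      (z ℤ.+ ℤ.- + 1) ℤ.* (z ℤ.+ ℤ.- + 1) ℤ.+ (z ℤ.+ + 1) ℤ.* (z ℤ.+ + 1)  ≡⟨ ring z ⟩
      + 2 ℤ.* (z ℤ.* z) ℤ.+ + 2     ≡⟨ cong (λ x → + 2 ℤ.* x ℤ.+ + 2) (+sq z) ⟨
      + 2 ℤ.* + sq z ℤ.+ + 2        ≡⟨ cong (ℤ._+ + 2) (ℤ.pos-* 2 (sq z)) ⟨
      + (2 * sq z + 2)              ∎)
      where
      open ≡-Reasoning
      ring : ∀ z → (z ℤ.+ ℤ.- + 1) ℤ.* (z ℤ.+ ℤ.- + 1) ℤ.+ (z ℤ.+ + 1) ℤ.* (z ℤ.+ + 1) ≡ + 2 ℤ.* (z ℤ.* z) ℤ.+ + 2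
      ring = ℤ-Solver.solve-∀

    digit-moment₃ : ∀ z → ∑ 3 (λ c → sq (z ℤ.+ centred-digit 3 c)) ≡ 3 * sq z + 8
    digit-moment₃ z = ℤ.+-injective (begin
      + (∑ 3 (λ c → sq (z ℤ.+ centred-digit 3 c)))     ≡⟨ cong₂ ℤ._+_ (cong₂ ℤ._+_ (+sq (z ℤ.+ ℤ.- + 2)) (+sq (z ℤ.+ + 0))) (+sq (z ℤ.+ + 2)) ⟩
      (z ℤ.+ ℤ.- + 2) ℤ.* (z ℤ.+ ℤ.- + 2) ℤ.+ (z ℤ.+ + 0) ℤ.* (z ℤ.+ + 0) ℤ.+ (z ℤ.+ + 2) ℤ.* (z ℤ.+ + 2)  ≡⟨ ring z ⟩
      + 3 ℤ.* (z ℤ.* z) ℤ.+ + 8     ≡⟨ cong (λ x → + 3 ℤ.* x ℤ.+ + 8) (+sq z) ⟨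
      + 3 ℤ.* + sq z ℤ.+ + 8        ≡⟨ cong (ℤ._+ + 8) (ℤ.pos-* 3 (sq z)) ⟨
      + (3 * sq z + 8)              ∎)
      where
      open ≡-Reasoning
      ring : ∀ z → (z ℤ.+ ℤ.- + 2) ℤ.* (z ℤ.+ ℤ.- + 2) ℤ.+ (z ℤ.+ + 0) ℤ.* (z ℤ.+ + 0) ℤ.+ (z ℤ.+ + 2) ℤ.* (z ℤ.+ + 2) ≡ + 3 ℤ.* (z ℤ.* z) ℤ.+ + 8
      ring = ℤ-Solver.solve-∀

    module Moment (q : ℕ) {q≥2 : True (2 ≤? q)} (K : ℕ)
      (digit-moment : ∀ z → ∑ q (λ c → sq (z ℤ.+ centred-digit q c)) ≡ q * sq z + K) where

      open DigitSum q {q≥2}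

      -- Twice the deviation of a digit sum x from its mean over h digits.
      dev : ℕ → ℕ → ℤ
      dev h x = + 2 ℤ.* + x ℤ.- + pred q ℤ.* + h

      V : ℕ → ℕ
      V h = ∑ (q ^ h) (λ x → sq (dev h (s x)))

      dev-+ : ∀ h k x y → dev (h + k) (x + y) ≡ dev h x ℤ.+ dev k y
      dev-+ h k x y = ring (+ pred q) (+ h) (+ k) (+ x) (+ y)
        where
        ring : ∀ p h k x y → + 2 ℤ.* (x ℤ.+ y) ℤ.- p ℤ.* (h ℤ.+ k) ≡ + 2 ℤ.* x ℤ.- p ℤ.* h ℤ.+ (+ 2 ℤ.* y ℤ.- p ℤ.* k)
        ring = ℤ-Solver.solve-∀

      -- Digits are independent: one more digit multiplies the moment by q and adds K q ^ h. The
      -- exact solution is K h q ^ (h - 1); a factor q is given away to avoid the predecessor of h.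
      V-bound : ∀ h → V h ≤ K * h * q ^ h
      V-bound zero = ≤-trans (≤-reflexive (trans (cong (λ x → sq (dev 0 x)) s-zero) (cong (λ x → sq (+ 0 ℤ.- x)) (ℤ.*-zeroʳ (+ pred q))))) z≤n
      V-bound (suc h) = begin
        V (suc h)                                                     ≡⟨ cong (λ n → ∑ n (λ x → sq (dev (suc h) (s x)))) (*-comm q (q ^ h)) ⟩
        ∑ (q ^ h * q) (λ x → sq (dev (suc h) (s x)))                  ≡⟨ ∑-blocks (q ^ h) q _ ⟩
        ∑ (q ^ h) (λ i → ∑ q (λ c → sq (dev (suc h) (s (c + i * q))))) ≡⟨ ∑-cong (q ^ h) (λ i _ → trans (∑-cong q (λ c c<q → cong sq (step i c c<q))) (digit-moment (dev h (s i)))) ⟩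
        ∑ (q ^ h) (λ i → q * sq (dev h (s i)) + K)                    ≡⟨ ∑-distrib-+ (q ^ h) _ _ ⟩
        ∑ (q ^ h) (λ i → q * sq (dev h (s i))) + ∑ (q ^ h) (λ _ → K)  ≡⟨ cong₂ _+_ (*-distrib-∑ (q ^ h) q _) (∑-const (q ^ h) K) ⟩
        q * V h + q ^ h * K                                           ≤⟨ +-mono-≤ (*-monoʳ-≤ q (V-bound h)) (m≤m*n (q ^ h * K) q) ⟩
        q * (K * h * q ^ h) + q ^ h * K * q                           ≡⟨ ring q K h (q ^ h) ⟩
        K * suc h * (q * q ^ h)                                       ∎
        where
        open ≤-Reasoning
        ring : ∀ q K h p → q * (K * h * p) + p * K * q ≡ K * suc h * (q * p)
        ring = solve-∀
        step : ∀ i c → c < q → dev (suc h) (s (c + i * q)) ≡ dev h (s i) ℤ.+ centred-digit q c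
        step i c c<q = trans (cong (dev (suc h)) (s-cons i c<q)) (ring′ (+ pred q) (+ h) (+ c) (+ s i))
          where
          ring′ : ∀ p h c x → + 2 ℤ.* (c ℤ.+ x) ℤ.- p ℤ.* (+ 1 ℤ.+ h) ≡ + 2 ℤ.* x ℤ.- p ℤ.* h ℤ.+ (+ 2 ℤ.* c ℤ.- p)
          ring′ = ℤ-Solver.solve-∀

  open Moments

  -- Second moments along arithmetic progressions

  coprime-^ : ∀ {m n} k → Coprime m n → Coprime (m ^ k) n
  coprime-^ zero    _   (d∣1 , _) = ∣1⇒≡1 d∣1
  coprime-^ {m} {n} (suc k) m⊥n {d} (d∣mm^k , d∣n) = coprime-^ k m⊥n
    (coprime-divisor (λ { (e∣d , e∣m) → m⊥n (e∣m , ∣-trans e∣d d∣n) }) d∣mm^k , d∣n)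

  %-≡⇒∣ : ∀ a d n .{{_ : NonZero n}} → a % n ≡ (a + d) % n → n ∣ d
  %-≡⇒∣ a d n eq = divides ((a + d) / n ∸ a / n) (begin
    d                                                             ≡⟨ m+n∸m≡n a d ⟨
    (a + d) ∸ a                                                   ≡⟨ cong₂ _∸_ (m≡m%n+[m/n]*n (a + d) n) (m≡m%n+[m/n]*n a n) ⟩
    ((a + d) % n + (a + d) / n * n) ∸ (a % n + a / n * n)         ≡⟨ cong (λ r → (r + (a + d) / n * n) ∸ (a % n + a / n * n)) eq ⟨
    (a % n + (a + d) / n * n) ∸ (a % n + a / n * n)               ≡⟨ [m+n]∸[m+o]≡n∸o (a % n) _ _ ⟩
    (a + d) / n * n ∸ a / n * n                                   ≡⟨ *-distribʳ-∸ n ((a + d) / n) (a / n) ⟨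
    ((a + d) / n ∸ a / n) * n                                     ∎)
    where open ≡-Reasoning

  a+n≤b⇒a/n≢b/n : ∀ {a b} n .{{_ : NonZero n}} → a + n ≤ b → a / n ≢ b / n
  a+n≤b⇒a/n≢b/n {a} {b} n a+n≤b eq = <⇒≱ (begin-strict
    b                    ≡⟨ m≡m%n+[m/n]*n b n ⟩
    b % n + b / n * n    <⟨ +-monoˡ-< (b / n * n) (m%n<n b n) ⟩
    n + b / n * n        ≡⟨ cong (λ w → n + w * n) eq ⟨
    n + a / n * n        ≤⟨ +-monoʳ-≤ n (m/n*n≤m a n) ⟩
    n + a                ≡⟨ +-comm n a ⟩
    a + n                ∎) a+n≤b
    where open ≤-Reasoning

  m≤[1+m/n]*n : ∀ m n .{{_ : NonZero n}} → m ≤ suc (m / n) * n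
  m≤[1+m/n]*n m n = ≤-trans (≤-reflexive (m≡m%n+[m/n]*n m n)) (+-monoˡ-≤ (m / n * n) (<⇒≤ (m%n<n m n)))

  module Progression (q : ℕ) {q≥2 : True (2 ≤? q)} (K : ℕ)
    (digit-moment : ∀ z → ∑ q (λ c → sq (z ℤ.+ centred-digit q c)) ≡ q * sq z + K) where

    open DigitSum q {q≥2}
    open Moment q {q≥2} K digit-moment

    private
      module Split {g X M} j r (X<g : X < g) (g≤q^j : g ≤ q ^ j) (q^j≤M : q ^ j ≤ M)
        (3gM≤ : 3 * (g * M) ≤ q ^ (j + r)) (≤9gM : q ^ (j + r) ≤ 9 * (g * M)) (coprime : Coprime (q ^ j) g) where

        instance
          q^j≢0 : NonZero (q ^ j)
          q^j≢0 = m^n≢0 q j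
          g≢0 : NonZero g
          g≢0 = >-nonZero (≤-<-trans z≤n X<g)

        low high : ℕ → ℕ
        low  u = (X + u * g) % q ^ j
        high u = (X + u * g) / q ^ j

        -- Since g is coprime to q ^ j, any q ^ j consecutive u give distinct residues, so each such
        -- block contributes at most `V j`. Rounding M up to whole blocks at most doubles it,
        -- because q ^ j ≤ M.
        low-moment : ∑ M (λ u → sq (dev j (s (low u)))) ≤ 2 * (K * j * M)
        low-moment = begin
          ∑ M f                                              ≤⟨ ∑-≤ f (m≤[1+m/n]*n M (q ^ j)) ⟩
          ∑ (B * q ^ j) f                                    ≡⟨ ∑-blocks B (q ^ j) f ⟩
          ∑ B (λ i → ∑ (q ^ j) (λ t → f (t + i * q ^ j)))    ≤⟨ ∑-mono B (λ i _ → ∑-injective (q ^ j) (λ t → low (t + i * q ^ j)) (λ y → sq (dev j (s y)))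
                                                                  (λ t _ → m%n<n _ (q ^ j)) (residues i)) ⟩
          ∑ B (λ _ → V j)                                    ≡⟨ ∑-const B (V j) ⟩
          B * V j                                            ≤⟨ *-monoʳ-≤ B (V-bound j) ⟩
          B * (K * j * q ^ j)                                ≡⟨ swap B (K * j) (q ^ j) ⟩
          K * j * (B * q ^ j)                                ≤⟨ *-monoʳ-≤ (K * j) (+-mono-≤ q^j≤M (m/n*n≤m M (q ^ j))) ⟩
          K * j * (M + M)                                    ≡⟨ twice (K * j) M ⟩
          2 * (K * j * M)                                    ∎
          where
          open ≤-Reasoning
          f : ℕ → ℕ
          f u = sq (dev j (s (low u)))
          B : ℕ
          B = suc (M / q ^ j)
          swap : ∀ x y z → x * (y * z) ≡ y * (x * z)
          swap = solve-∀
          twice : ∀ x y → x * (y + y) ≡ 2 * (x * y)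
          twice = solve-∀
          residues : ∀ i {t t′} → t < t′ → t′ < q ^ j → low (t + i * q ^ j) ≢ low (t′ + i * q ^ j)
          residues i {t} {t′} t<t′ t′<q^j eq = <⇒≱ t′<q^j (≤-trans
            (∣⇒≤ {{>-nonZero (m<n⇒0<n∸m t<t′)}} (coprime-divisor coprime (%-≡⇒∣ (X + (t + i * q ^ j) * g) (g * (t′ ∸ t)) (q ^ j)
              (trans eq (cong (_% q ^ j) (trans (cong (λ t → X + (t + i * q ^ j) * g) (sym (m+[n∸m]≡n (<⇒≤ t<t′)))) (ring X t (t′ ∸ t) (i * q ^ j) g)))))))
            (m∸n≤m t′ t))
            where
            ring : ∀ X t d o g → X + (t + d + o) * g ≡ X + (t + o) * g + g * d
            ring = solve-∀

        -- Indices at distance k = ⌊q ^ j / g⌋ + 1 give terms at least q ^ j apart, hence different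
        -- high parts. Sorting u by its residue modulo k yields k injective families, each
        -- contributing at most `V r`; the factor 18 comes from k g ≤ 2 q ^ j and q ^ (j + r) ≤ 9 g
        -- M.
        high-moment : ∑ M (λ u → sq (dev r (s (high u)))) ≤ 18 * (K * r * M)
        high-moment = begin
          ∑ M f                                              ≤⟨ ∑-≤ f (m≤[1+m/n]*n M k) ⟩
          ∑ (P * k) f                                        ≡⟨ ∑-blocks P k f ⟩
          ∑ P (λ i → ∑ k (λ c → f (c + i * k)))              ≡⟨ ∑-swap P k _ ⟩
          ∑ k (λ c → ∑ P (λ i → f (c + i * k)))              ≤⟨ ∑-mono k (λ c c<k → ∑-injective P (λ i → high (c + i * k)) (λ y → sq (dev r (s y)))
                                                                  (λ i i<P → in-range (b+c*d<a*d c<k i<P)) (λ i<i′ _ → a+n≤b⇒a/n≢b/n (q ^ j) (gap c i<i′))) ⟩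
          ∑ k (λ _ → V r)                                    ≡⟨ ∑-const k (V r) ⟩
          k * V r                                            ≤⟨ *-cancelˡ-≤ g scaled ⟩
          18 * (K * r * M)                                   ∎
          where
          open ≤-Reasoning
          f : ℕ → ℕ
          f u = sq (dev r (s (high u)))
          k P : ℕ
          k = suc (q ^ j / g)
          P = suc (M / k)
          k≤2M : k ≤ 2 * M
          k≤2M = begin
            suc (q ^ j / g)     ≤⟨ s≤s (m/n≤m (q ^ j) g) ⟩
            1 + q ^ j           ≤⟨ +-mono-≤ (≤-trans (m^n>0 q j) q^j≤M) q^j≤M ⟩
            M + M               ≡⟨ cong (M +_) (+-identityʳ M) ⟨
            2 * M               ∎
          -- Rounding M up to P k may triple it, which is the reason for the factor 3 in the
          -- hypothesis `3gM≤`.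
          in-range : ∀ {u} → u < P * k → high u < q ^ r
          in-range {u} u<Pk = m<n*o⇒m/o<n (begin-strict
            X + u * g           <⟨ +-monoˡ-< (u * g) X<g ⟩
            suc u * g           ≤⟨ *-monoˡ-≤ g u<Pk ⟩
            (k + M / k * k) * g ≤⟨ *-monoˡ-≤ g (+-mono-≤ k≤2M (m/n*n≤m M k)) ⟩
            (2 * M + M) * g     ≡⟨ ring M g ⟩
            3 * (g * M)         ≤⟨ 3gM≤ ⟩
            q ^ (j + r)         ≡⟨ ^-distribˡ-+-* q j r ⟩
            q ^ j * q ^ r       ≡⟨ *-comm (q ^ j) (q ^ r) ⟩
            q ^ r * q ^ j       ∎)
            where
            ring : ∀ M g → (2 * M + M) * g ≡ 3 * (g * M)
            ring = solve-∀
          gap : ∀ c {i i′} → i < i′ → X + (c + i * k) * g + q ^ j ≤ X + (c + i′ * k) * g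
          gap c {i} {i′} i<i′ = begin
            X + (c + i * k) * g + q ^ j      ≤⟨ +-monoʳ-≤ _ (m≤[1+m/n]*n (q ^ j) g) ⟩
            X + (c + i * k) * g + k * g      ≡⟨ ring X c i k g ⟩
            X + (c + suc i * k) * g          ≤⟨ +-monoʳ-≤ X (*-monoˡ-≤ g (+-monoʳ-≤ c (*-monoˡ-≤ k i<i′))) ⟩
            X + (c + i′ * k) * g             ∎
            where
            ring : ∀ X c i k g → X + (c + i * k) * g + k * g ≡ X + (c + suc i * k) * g
            ring = solve-∀
          scaled : g * (k * V r) ≤ g * (18 * (K * r * M))
          scaled = begin
            g * (k * V r)                      ≤⟨ *-monoʳ-≤ g (*-monoʳ-≤ k (V-bound r)) ⟩
            g * (k * (K * r * q ^ r))          ≡⟨ ring₁ g k (K * r) (q ^ r) ⟩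
            K * r * (k * g * q ^ r)            ≤⟨ *-monoʳ-≤ (K * r) (*-monoˡ-≤ (q ^ r) (+-mono-≤ g≤q^j (m/n*n≤m (q ^ j) g))) ⟩
            K * r * ((q ^ j + q ^ j) * q ^ r)  ≡⟨ ring₂ (K * r) (q ^ j) (q ^ r) ⟩
            2 * (K * r) * (q ^ j * q ^ r)      ≡⟨ cong (2 * (K * r) *_) (^-distribˡ-+-* q j r) ⟨
            2 * (K * r) * q ^ (j + r)          ≤⟨ *-monoʳ-≤ (2 * (K * r)) ≤9gM ⟩
            2 * (K * r) * (9 * (g * M))        ≡⟨ ring₃ (K * r) g M ⟩
            g * (18 * (K * r * M))             ∎
            where
            ring₁ : ∀ g k x p → g * (k * (x * p)) ≡ x * (k * g * p)
            ring₁ = solve-∀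
            ring₂ : ∀ x p o → x * ((p + p) * o) ≡ 2 * x * (p * o)
            ring₂ = solve-∀
            ring₃ : ∀ x g M → 2 * x * (9 * (g * M)) ≡ g * (18 * (x * M))
            ring₃ = solve-∀

        -- The low and high parts of one term are correlated; `sq-+` disposes of the cross term at
        -- the cost of a factor 2.
        sq-dev : ∀ u → sq (dev (j + r) (s (X + u * g))) ≤ 2 * (sq (dev j (s (low u))) + sq (dev r (s (high u))))
        sq-dev u = begin
          sq (dev (j + r) (s (X + u * g)))                       ≡⟨ cong (λ n → sq (dev (j + r) (s n))) (m≡m%n+[m/n]*n (X + u * g) (q ^ j)) ⟩
          sq (dev (j + r) (s (low u + high u * q ^ j)))          ≡⟨ cong (λ x → sq (dev (j + r) x)) (s-block j (high u) (m%n<n (X + u * g) (q ^ j))) ⟩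
          sq (dev (j + r) (s (low u) + s (high u)))              ≡⟨ cong sq (dev-+ j r (s (low u)) (s (high u))) ⟩
          sq (dev j (s (low u)) ℤ.+ dev r (s (high u)))          ≤⟨ sq-+ (dev j (s (low u))) (dev r (s (high u))) ⟩
          2 * (sq (dev j (s (low u))) + sq (dev r (s (high u)))) ∎
          where open ≤-Reasoning

    -- The lowest j digits of X + u g run through all residues equally
    -- often, and the top r digits take each value at most q ^ j / g + 1
    -- times.
    progression-moment : ∀ {g X M} j r → X < g → g ≤ q ^ j → q ^ j ≤ M →
      3 * (g * M) ≤ q ^ (j + r) → q ^ (j + r) ≤ 9 * (g * M) → Coprime q g →
      ∑ M (λ u → sq (dev (j + r) (s (X + u * g)))) ≤ 36 * K * (j + r) * M
    progression-moment {g} {X} {M} j r X<g g≤q^j q^j≤M 3gM≤ ≤9gM coprime = begin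
      ∑ M (λ u → sq (dev (j + r) (s (X + u * g))))         ≤⟨ ∑-mono M (λ u _ → sq-dev u) ⟩
      ∑ M (λ u → 2 * (f u + h u))                          ≡⟨ *-distrib-∑ M 2 _ ⟩
      2 * ∑ M (λ u → f u + h u)                            ≡⟨ cong (2 *_) (∑-distrib-+ M f h) ⟩
      2 * (∑ M f + ∑ M h)                                  ≤⟨ *-monoʳ-≤ 2 (+-mono-≤ low-moment high-moment) ⟩
      2 * (2 * (K * j * M) + 18 * (K * r * M))             ≤⟨ m≤m+n _ (32 * (K * j * M)) ⟩
      2 * (2 * (K * j * M) + 18 * (K * r * M)) + 32 * (K * j * M)  ≡⟨ ring K j r M ⟩
      36 * K * (j + r) * M                                 ∎
      where
      open ≤-Reasoning
      open Split j r X<g g≤q^j q^j≤M 3gM≤ ≤9gM (coprime-^ j coprime)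
      f h : ℕ → ℕ
      f u = sq (dev j (s (low u)))
      h u = sq (dev r (s (high u)))
      ring : ∀ K j r M → 2 * (2 * (K * j * M) + 18 * (K * r * M)) + 32 * (K * j * M) ≡ 36 * K * (j + r) * M
      ring = solve-∀

  -- From adjusters to collisions

  collides? : ∀ n → Dec (digitSum 2 n ≡ digitSum 3 n)
  collides? n = digitSum 2 n ≟ digitSum 3 n

  -- An indicator function, in the form `filter` gives it, so that `∑-collision` only has to take a
  -- list apart.
  collision : ℕ → ℕ
  collision n = length (filter collides? [ n ])

  collision-≡ : ∀ {n} → s₂ n ≡ s₃ n → collision n ≡ 1
  collision-≡ {n} eq = cong length (filter-accept collides? {n} {[]}
    (trans (sym (Two.s≡digitSum n)) (trans eq (Three.s≡digitSum n))))

  ∑-collision : ∀ N → ∑ N collision ≡ collisions N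
  ∑-collision zero    = refl
  ∑-collision (suc N) = begin
    ∑ N collision + collision N                                ≡⟨ cong (_+ collision N) (∑-collision N) ⟩
    length (filter collides? (upTo N)) + length (filter collides? [ N ])     ≡⟨ length-++ (filter collides? (upTo N)) ⟨
    length (filter collides? (upTo N) ++ filter collides? [ N ])             ≡⟨ cong length (filter-++ collides? (upTo N) [ N ]) ⟨
    length (filter collides? (upTo N ∷ʳ N))                           ≡⟨ cong (λ ns → length (filter collides? ns)) (applyUpTo-∷ʳ id N) ⟩
    collisions (suc N)                                         ∎
    where open ≡-Reasoning

  collisions-mono : ∀ {M N} → M ≤ N → collisions M ≤ collisions N
  collisions-mono {M} {N} M≤N = subst₂ _≤_ (∑-collision M) (∑-collision N) (∑-≤ collision M≤N)

  private
    crt-Bézout : ∀ m n x y {x₁ x₂} .{{_ : NonZero n}} → 1 + y * n ≡ x * m → x₁ < m → x₂ < n →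
                 ∃[ X₁ ] ∃[ X₂ ] (X₁ < n × X₂ < m × x₁ + X₁ * m ≡ x₂ + X₂ * n)
    crt-Bézout m n@(suc n-1) x y {x₁} {x₂} bézout x₁<m x₂<n =
      X % n , t / n , m%n<n X n , m<n*o⇒m/o<n (<-≤-trans (b+c*d<a*d x₁<m (m%n<n X n)) (≤-reflexive (*-comm n m))) ,
      trans (m≡m%n+[m/n]*n t n) (cong (_+ t / n * n) t%n≡x₂)
      where
      open ≡-Reasoning
      z X t : ℕ
      -- Modulo n the factor n - 1 acts as -1, so z stands for x₂ - x₁ without subtraction;
      -- multiplying by x, an inverse of m modulo n, gives the wanted multiplier of m.
      z = x₂ + n-1 * x₁
      X = x * z
      t = x₁ + X % n * m
      t%n≡x₂ : t % n ≡ x₂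
      t%n≡x₂ = begin
        t % n                                  ≡⟨ [m+kn]%n≡m%n t (X / n * m) n ⟨
        (t + X / n * m * n) % n                ≡⟨ cong (_% n) (ring₁ x₁ (X % n) (X / n) m n) ⟩
        (x₁ + (X % n + X / n * n) * m) % n     ≡⟨ cong (λ w → (x₁ + w * m) % n) (m≡m%n+[m/n]*n X n) ⟨
        (x₁ + x * z * m) % n                   ≡⟨ cong (_% n) (ring₂ x₁ x z m) ⟩
        (x₁ + x * m * z) % n                   ≡⟨ cong (λ w → (x₁ + w * z) % n) bézout ⟨
        (x₁ + (1 + y * n) * z) % n             ≡⟨ cong (_% n) (ring₃ x₁ x₂ y n-1) ⟩
        (x₂ + (x₁ + y * z) * n) % n            ≡⟨ [m+kn]%n≡m%n x₂ (x₁ + y * z) n ⟩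
        x₂ % n                                 ≡⟨ m<n⇒m%n≡m x₂<n ⟩
        x₂                                     ∎
        where
        ring₁ : ∀ x₁ r k m n → x₁ + r * m + k * m * n ≡ x₁ + (r + k * n) * m
        ring₁ = solve-∀
        ring₂ : ∀ x₁ x z m → x₁ + x * z * m ≡ x₁ + x * m * z
        ring₂ = solve-∀
        ring₃ : ∀ x₁ x₂ y p → x₁ + (1 + y * suc p) * (x₂ + p * x₁) ≡ x₂ + (x₁ + y * (x₂ + p * x₁)) * suc p
        ring₃ = solve-∀

  chinese-remainder : ∀ {m n x₁ x₂} → Coprime m n → x₁ < m → x₂ < n →
    ∃[ X₁ ] ∃[ X₂ ] (X₁ < n × X₂ < m × x₁ + X₁ * m ≡ x₂ + X₂ * n)
  chinese-remainder {m} {n} m⊥n x₁<m x₂<n with coprime-Bézout m⊥n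
  ... | Bézout.+- x y eq = crt-Bézout m n x y {{>-nonZero (≤-<-trans z≤n x₂<n)}} eq x₁<m x₂<n
  ... | Bézout.-+ x y eq with X₂ , X₁ , X₂<m , X₁<n , t ← crt-Bézout n m y x {{>-nonZero (≤-<-trans z≤n x₁<m)}} eq x₂<n x₁<m
    = X₁ , X₂ , X₁<n , X₂<m , sym t

  2⊥3 : Coprime 2 3
  2⊥3 = from-yes (coprime? 2 3)

  module Moment₂ = Moment 2 2 digit-moment₂
  module Moment₃ = Moment 3 8 digit-moment₃

  -- The adjuster turns n = x + u 2ᵃ 3ᵇ into a collision n + e unless one
  -- of the two deviations is large.
  module Adjusted {a b W x₁ x₂ X₁ X₂ H₂ H₃ : ℕ}
    (adjust : ∀ D → D < W → ∃[ e ] (x₁ + e < 2 ^ a × x₂ + e < 3 ^ b × s₂ (x₁ + e) + s₃ x₂ ≡ s₃ (x₂ + e) + s₂ x₁ + D))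
    (X₁< : X₁ < 3 ^ b) (x₁< : x₁ < 2 ^ a)
    (x≡ : x₁ + X₁ * 2 ^ a ≡ x₂ + X₂ * 3 ^ b)
    (balance : H₂ + (W + 2 * s₂ x₁) ≡ 2 * H₃ + 2 * s₃ x₂) where

    G : ℕ
    G = 2 ^ a * 3 ^ b

    A B : ℕ → ℕ
    A u = s₂ (X₁ + u * 3 ^ b)
    B u = s₃ (X₂ + u * 2 ^ a)

    deviation : ℕ → ℕ
    deviation u = sq (Moment₂.dev H₂ (A u)) + sq (Moment₃.dev H₃ (B u))

    private
      large : ∀ u {w} → W ≤ w → ∣ Moment₂.dev H₂ (A u) ℤ.- Moment₃.dev H₃ (B u) ∣ ≡ w → W * W ≤ 2 * deviation u
      large u {w} W≤w eq = begin
        W * W                            ≤⟨ *-mono-≤ W≤w W≤w ⟩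
        w * w                            ≡⟨ cong (λ x → x * x) eq ⟨
        sq (d₂ ℤ.+ ℤ.- d₃)               ≤⟨ sq-+ d₂ (ℤ.- d₃) ⟩
        2 * (sq d₂ + sq (ℤ.- d₃))        ≡⟨ cong (λ x → 2 * (sq d₂ + x * x)) (ℤ.∣-i∣≡∣i∣ d₃) ⟩
        2 * (sq d₂ + sq d₃)              ∎
        where
        open ≤-Reasoning
        d₂ d₃ : ℤ
        d₂ = Moment₂.dev H₂ (A u)
        d₃ = Moment₃.dev H₃ (B u)

      -- The two deviations differ by W + 2 k, where k is the excess of s₂ over s₃ before
      -- correction. A correction exists for -W < k ≤ 0. Thus `balance` puts the zero of the
      -- difference at the centre of this window, and outside the window its absolute value is at
      -- least W.
      difference : ∀ α β σ τ (k : ℤ) → α ℤ.+ σ ≡ β ℤ.+ τ ℤ.+ k → ∀ h h′ w → h ℤ.+ (w ℤ.+ ℤ.+ 2 ℤ.* σ) ≡ ℤ.+ 2 ℤ.* h′ ℤ.+ ℤ.+ 2 ℤ.* τ →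
        (ℤ.+ 2 ℤ.* α ℤ.- ℤ.+ 1 ℤ.* h) ℤ.- (ℤ.+ 2 ℤ.* β ℤ.- ℤ.+ 2 ℤ.* h′) ≡ w ℤ.+ ℤ.+ 2 ℤ.* k
      difference α β σ τ k eq h h′ w bal = begin
        (ℤ.+ 2 ℤ.* α ℤ.- ℤ.+ 1 ℤ.* h) ℤ.- (ℤ.+ 2 ℤ.* β ℤ.- ℤ.+ 2 ℤ.* h′)   ≡⟨ ring α β σ τ k h h′ w ⟩
        w ℤ.+ ℤ.+ 2 ℤ.* k ℤ.+ ℤ.+ 2 ℤ.* (α ℤ.+ σ ℤ.- (β ℤ.+ τ ℤ.+ k)) ℤ.- (h ℤ.+ (w ℤ.+ ℤ.+ 2 ℤ.* σ) ℤ.- (ℤ.+ 2 ℤ.* h′ ℤ.+ ℤ.+ 2 ℤ.* τ))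
          ≡⟨ cong₂ (λ x y → w ℤ.+ ℤ.+ 2 ℤ.* k ℤ.+ ℤ.+ 2 ℤ.* x ℤ.- y) (ℤ.i≡j⇒i-j≡0 eq) (ℤ.i≡j⇒i-j≡0 bal) ⟩
        w ℤ.+ ℤ.+ 2 ℤ.* k ℤ.+ ℤ.+ 0 ℤ.- ℤ.+ 0          ≡⟨ trans (ℤ.+-identityʳ _) (ℤ.+-identityʳ _) ⟩
        w ℤ.+ ℤ.+ 2 ℤ.* k                              ∎
        where
        open ≡-Reasoning
        ring : ∀ α β σ τ k h h′ w → (ℤ.+ 2 ℤ.* α ℤ.- ℤ.+ 1 ℤ.* h) ℤ.- (ℤ.+ 2 ℤ.* β ℤ.- ℤ.+ 2 ℤ.* h′)
          ≡ w ℤ.+ ℤ.+ 2 ℤ.* k ℤ.+ ℤ.+ 2 ℤ.* (α ℤ.+ σ ℤ.- (β ℤ.+ τ ℤ.+ k)) ℤ.- (h ℤ.+ (w ℤ.+ ℤ.+ 2 ℤ.* σ) ℤ.- (ℤ.+ 2 ℤ.* h′ ℤ.+ ℤ.+ 2 ℤ.* τ))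
        ring = ℤ-Solver.solve-∀

      balanceℤ : ℤ.+ H₂ ℤ.+ (ℤ.+ W ℤ.+ ℤ.+ 2 ℤ.* ℤ.+ s₂ x₁) ≡ ℤ.+ 2 ℤ.* ℤ.+ H₃ ℤ.+ ℤ.+ 2 ℤ.* ℤ.+ s₃ x₂
      balanceℤ = begin
        ℤ.+ H₂ ℤ.+ (ℤ.+ W ℤ.+ ℤ.+ 2 ℤ.* ℤ.+ s₂ x₁)   ≡⟨ cong (λ x → ℤ.+ H₂ ℤ.+ (ℤ.+ W ℤ.+ x)) (ℤ.pos-* 2 (s₂ x₁)) ⟨
        ℤ.+ (H₂ + (W + 2 * s₂ x₁))                   ≡⟨ cong ℤ.+_ balance ⟩
        ℤ.+ (2 * H₃ + 2 * s₃ x₂)                     ≡⟨ cong₂ ℤ._+_ (ℤ.pos-* 2 H₃) (ℤ.pos-* 2 (s₃ x₂)) ⟩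
        ℤ.+ 2 ℤ.* ℤ.+ H₃ ℤ.+ ℤ.+ 2 ℤ.* ℤ.+ s₃ x₂     ∎
        where open ≡-Reasoning

      too-high : ∀ u {k} → A u + s₂ x₁ ≡ B u + s₃ x₂ + k → W * W ≤ 2 * deviation u
      too-high u {k} eq = large u (m≤m+n W (2 * k)) (cong ∣_∣ (begin
        Moment₂.dev H₂ (A u) ℤ.- Moment₃.dev H₃ (B u)    ≡⟨ difference (ℤ.+ A u) (ℤ.+ B u) (ℤ.+ s₂ x₁) (ℤ.+ s₃ x₂) (ℤ.+ k) (cong ℤ.+_ eq) (ℤ.+ H₂) (ℤ.+ H₃) (ℤ.+ W) balanceℤ ⟩
        ℤ.+ W ℤ.+ ℤ.+ 2 ℤ.* ℤ.+ k                        ≡⟨ cong (λ x → ℤ.+ W ℤ.+ x) (ℤ.pos-* 2 k) ⟨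
        ℤ.+ (W + 2 * k)                                  ∎))
        where open ≡-Reasoning

      too-low : ∀ u {k} → A u + s₂ x₁ + (W + k) ≡ B u + s₃ x₂ → W * W ≤ 2 * deviation u
      too-low u {k} eq = large u (m≤m+n W (2 * k)) (trans (cong ∣_∣ (begin
        Moment₂.dev H₂ (A u) ℤ.- Moment₃.dev H₃ (B u)    ≡⟨ difference (ℤ.+ A u) (ℤ.+ B u) (ℤ.+ s₂ x₁) (ℤ.+ s₃ x₂) (ℤ.- ℤ.+ (W + k))
                                                              (trans (cancel (ℤ.+ (A u + s₂ x₁)) (ℤ.+ (W + k))) (cong (λ x → x ℤ.- ℤ.+ (W + k)) (cong ℤ.+_ eq))) (ℤ.+ H₂) (ℤ.+ H₃) (ℤ.+ W) balanceℤ ⟩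
        ℤ.+ W ℤ.+ ℤ.+ 2 ℤ.* (ℤ.- (ℤ.+ W ℤ.+ ℤ.+ k))      ≡⟨ ring (ℤ.+ W) (ℤ.+ k) ⟩
        ℤ.- (ℤ.+ W ℤ.+ ℤ.+ 2 ℤ.* ℤ.+ k)                  ≡⟨ cong (λ x → ℤ.- (ℤ.+ W ℤ.+ x)) (ℤ.pos-* 2 k) ⟨
        ℤ.- ℤ.+ (W + 2 * k)                              ∎)) (ℤ.∣-i∣≡∣i∣ (ℤ.+ (W + 2 * k))))
        where
        open ≡-Reasoning
        cancel : ∀ x y → x ≡ x ℤ.+ y ℤ.- y
        cancel = ℤ-Solver.solve-∀
        ring : ∀ w k → w ℤ.+ ℤ.+ 2 ℤ.* (ℤ.- (w ℤ.+ k)) ≡ ℤ.- (w ℤ.+ ℤ.+ 2 ℤ.* k)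
        ring = ℤ-Solver.solve-∀

      -- The number is cut above a binary digits and above b ternary digits. Adding e reaches
      -- neither cut, so it alters only the low blocks, where `adjust` supplies the missing D.
      hit : ∀ u D → A u + s₂ x₁ + D ≡ B u + s₃ x₂ → D < W →
            ∃[ e ] (e < 2 ^ a × collision (x₁ + X₁ * 2 ^ a + u * G + e) ≡ 1)
      hit u D eq D<W with e , e₁ , e₂ , adj ← adjust D D<W
        = e , ≤-<-trans (m≤n+m e x₁) e₁ , collision-≡ {n} (+-cancelʳ-≡ (s₃ x₂) (s₂ n) (s₃ n) (begin
          s₂ n + s₃ x₂                           ≡⟨ cong (_+ s₃ x₂) (trans (cong s₂ n≡₂) (Two.s-block a (X₁ + u * 3 ^ b) e₁)) ⟩
          s₂ (x₁ + e) + A u + s₃ x₂              ≡⟨ swap (s₂ (x₁ + e)) (A u) (s₃ x₂) ⟩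
          s₂ (x₁ + e) + s₃ x₂ + A u              ≡⟨ cong (_+ A u) adj ⟩
          s₃ (x₂ + e) + s₂ x₁ + D + A u          ≡⟨ regroup (s₃ (x₂ + e)) (s₂ x₁) D (A u) ⟩
          s₃ (x₂ + e) + (A u + s₂ x₁ + D)        ≡⟨ cong (s₃ (x₂ + e) +_) eq ⟩
          s₃ (x₂ + e) + (B u + s₃ x₂)            ≡⟨ +-assoc (s₃ (x₂ + e)) (B u) (s₃ x₂) ⟨
          s₃ (x₂ + e) + B u + s₃ x₂              ≡⟨ cong (_+ s₃ x₂) (trans (cong s₃ n≡₃) (Three.s-block b (X₂ + u * 2 ^ a) e₂)) ⟨
          s₃ n + s₃ x₂                           ∎))
        where
        open ≡-Reasoning
        n : ℕ
        n = x₁ + X₁ * 2 ^ a + u * G + e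
        swap : ∀ x y z → x + y + z ≡ x + z + y
        swap = solve-∀
        regroup : ∀ x y z w → x + y + z + w ≡ x + (w + y + z)
        regroup = solve-∀
        expand₂ : ∀ x e X u p g → x + X * p + u * (p * g) + e ≡ x + e + (X + u * g) * p
        expand₂ = solve-∀
        expand₃ : ∀ x e X u p g → x + X * g + u * (p * g) + e ≡ x + e + (X + u * p) * g
        expand₃ = solve-∀
        n≡₂ : n ≡ x₁ + e + (X₁ + u * 3 ^ b) * 2 ^ a
        n≡₂ = expand₂ x₁ e X₁ u (2 ^ a) (3 ^ b)
        n≡₃ : n ≡ x₂ + e + (X₂ + u * 2 ^ a) * 3 ^ b
        n≡₃ = trans (cong (λ x → x + u * G + e) x≡) (expand₃ x₂ e X₂ u (2 ^ a) (3 ^ b))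

      -- A pointwise Markov inequality: either the indicator is 1 or the deviation is at least W ² /
      -- 2. Summing it over u avoids counting the exceptional u.
      Correction : ℕ → Set
      Correction u = ∃[ e ] (e < 2 ^ a × W * W ≤ W * W * collision (x₁ + X₁ * 2 ^ a + u * G + e) + 2 * deviation u)

      none : ∀ u → W * W ≤ 2 * deviation u → Correction u
      -- Here e = 0 is a default value; the deviation alone gives the inequality.
      none u W²≤ = 0 , m^n>0 2 a , m≤n⇒m≤o+n (W * W * collision (x₁ + X₁ * 2 ^ a + u * G + 0)) W²≤

      correction : ∀ u → Correction u
      correction u = decide (A u + s₂ x₁ ≤? B u + s₃ x₂) (W ≤? (B u + s₃ x₂) ∸ (A u + s₂ x₁))
        where
        decide : Dec (A u + s₂ x₁ ≤ B u + s₃ x₂) → Dec (W ≤ (B u + s₃ x₂) ∸ (A u + s₂ x₁)) → Correction u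
        decide (no ≰)  _ = none u (too-high u (sym (m+[n∸m]≡n (≰⇒≥ ≰))))
        decide (yes p) (yes W≤) = none u (too-low u (trans (cong (A u + s₂ x₁ +_) (m+[n∸m]≡n W≤)) (m+[n∸m]≡n p)))
        decide (yes p) (no W≰) = let e , e< , eq = hit u _ (m+[n∸m]≡n p) (≰⇒> W≰) in
          e , e< , ≤-trans (≤-reflexive (trans (sym (*-identityʳ (W * W))) (cong (W * W *_) (sym eq)))) (m≤m+n _ _)

    φ : ℕ → ℕ
    φ u = x₁ + X₁ * 2 ^ a + u * G + proj₁ (correction u)

    private
      φ-next : ∀ u → φ u < x₁ + X₁ * 2 ^ a + suc u * G
      φ-next u = begin-strict
        x + u * G + proj₁ (correction u)  <⟨ +-monoʳ-< (x + u * G) (proj₁ (proj₂ (correction u))) ⟩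
        x + u * G + 2 ^ a                 ≤⟨ +-monoʳ-≤ (x + u * G) (m≤m*n (2 ^ a) (3 ^ b) {{m^n≢0 3 b}}) ⟩
        x + u * G + G                     ≡⟨ +-assoc x (u * G) G ⟩
        x + (u * G + G)                   ≡⟨ cong (x +_) (+-comm (u * G) G) ⟩
        x + suc u * G                     ∎
        where
        open ≤-Reasoning
        x : ℕ
        x = x₁ + X₁ * 2 ^ a

      φ-increasing : ∀ {u u′} → u < u′ → φ u < φ u′
      φ-increasing {u} {u′} u<u′ = <-≤-trans (φ-next u)
        (≤-trans (+-monoʳ-≤ (x₁ + X₁ * 2 ^ a) (*-monoˡ-≤ G u<u′)) (m≤m+n _ _))

      φ-bound : ∀ {u M} → u < M → φ u < 2 * (M * G)
      φ-bound {u} {M} u<M = begin-strict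
        φ u                              <⟨ φ-next u ⟩
        x₁ + X₁ * 2 ^ a + suc u * G      ≤⟨ +-mono-≤ (<⇒≤ (b+c*d<a*d x₁< X₁<)) (*-monoˡ-≤ G u<M) ⟩
        3 ^ b * 2 ^ a + M * G            ≡⟨ cong (_+ M * G) (*-comm (3 ^ b) (2 ^ a)) ⟩
        G + M * G                        ≤⟨ +-monoˡ-≤ (M * G) (m≤n*m G M {{>-nonZero (≤-<-trans z≤n u<M)}}) ⟩
        M * G + M * G                    ≡⟨ cong (M * G +_) (+-identityʳ (M * G)) ⟨
        2 * (M * G)                      ∎
        where open ≤-Reasoning

    -- As e < 2 ^ a never reaches the next term of the progression, the integers `φ u` are distinct
    -- and their collisions are counted by `collisions N`.
    many : ∀ M {N} → 2 * (M * G) ≤ N → W * W * M ≤ W * W * collisions N + 2 * ∑ M deviation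
    many M {N} 2MG≤N = begin
      W * W * M                                                      ≡⟨ trans (*-comm (W * W) M) (sym (∑-const M (W * W))) ⟩
      ∑ M (λ _ → W * W)                                              ≤⟨ ∑-mono M (λ u _ → proj₂ (proj₂ (correction u))) ⟩
      ∑ M (λ u → W * W * collision (φ u) + 2 * deviation u)          ≡⟨ ∑-distrib-+ M _ _ ⟩
      ∑ M (λ u → W * W * collision (φ u)) + ∑ M (λ u → 2 * deviation u)  ≡⟨ cong₂ _+_ (*-distrib-∑ M (W * W) _) (*-distrib-∑ M 2 deviation) ⟩
      W * W * ∑ M (λ u → collision (φ u)) + 2 * ∑ M deviation        ≤⟨ +-monoˡ-≤ _ (*-monoʳ-≤ (W * W)
                                                                          (∑-injective M φ collision (λ _ u<M → <-≤-trans (φ-bound u<M) 2MG≤N) (λ u<u′ _ → <⇒≢ (φ-increasing u<u′)))) ⟩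
      W * W * ∑ N collision + 2 * ∑ M deviation                      ≡⟨ cong (λ c → W * W * c + 2 * ∑ M deviation) (∑-collision N) ⟩
      W * W * collisions N + 2 * ∑ M deviation                       ∎
      where open ≤-Reasoning

  -- Choice of the digit lengths for given L

  ^-cancelʳ-≤ : ∀ q {m n} → .{{NonZero q}} → 1 < q → q ^ m ≤ q ^ n → m ≤ n
  ^-cancelʳ-≤ q {m} {n} 1<q q^m≤q^n = s≤s⁻¹ (^-cancelʳ-< q (≤-<-trans q^m≤q^n (^-monoʳ-< q 1<q (n<1+n n))))

  ^-cancelˡ-≤ : ∀ k {m n} → m ^ suc k ≤ n ^ suc k → m ≤ n
  ^-cancelˡ-≤ k m^k≤n^k = ≮⇒≥ (λ n<m → <⇒≱ (^-monoˡ-< (suc k) n<m) m^k≤n^k)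

  -- Rests on 3 ^ 5 = 243 ≤ 256 = 2 ^ 8, that is, log 3 / log 2 ≤ 8/5.
  3^-≤-2^ : ∀ {m n} → 8 * m ≤ 5 * n → 3 ^ m ≤ 2 ^ n
  3^-≤-2^ {m} {n} 8m≤5n = ^-cancelˡ-≤ 4 (begin
    (3 ^ m) ^ 5     ≡⟨ trans (^-*-assoc 3 m 5) (trans (cong (3 ^_) (*-comm m 5)) (sym (^-*-assoc 3 5 m))) ⟩
    243 ^ m         ≤⟨ ^-monoˡ-≤ m {243} {256} (m≤m+n 243 13) ⟩
    256 ^ m         ≡⟨ ^-*-assoc 2 8 m ⟩
    2 ^ (8 * m)     ≤⟨ ^-monoʳ-≤ 2 8m≤5n ⟩
    2 ^ (5 * n)     ≡⟨ trans (cong (2 ^_) (*-comm 5 n)) (sym (^-*-assoc 2 n 5)) ⟩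
    (2 ^ n) ^ 5     ∎)
    where open ≤-Reasoning

  -- 216 and 576 are the constants of `moment₂` and `moment₃`, and 3168 = 4 (216 + 576): for w = W ²
  -- this large, at least half of the M indices yield collisions.
  markov : ∀ {w M C T D} .{{_ : NonZero w}} → w * M ≤ w * C + 2 * D → D ≤ 216 * T + 576 * T → 3168 * T ≤ w * M → M ≤ 2 * C
  markov {w} {M} {C} {T} {D} wM≤ D≤ T≤ = *-cancelˡ-≤ w (+-cancelʳ-≤ (w * M) _ _ (begin
    w * M + w * M                          ≡⟨ cong (w * M +_) (+-identityʳ (w * M)) ⟨
    2 * (w * M)                            ≤⟨ *-monoʳ-≤ 2 wM≤ ⟩
    2 * (w * C + 2 * D)                    ≤⟨ *-monoʳ-≤ 2 (+-monoʳ-≤ (w * C) (*-monoʳ-≤ 2 D≤)) ⟩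
    2 * (w * C + 2 * (216 * T + 576 * T))  ≡⟨ ring w C T ⟩
    w * (2 * C) + 3168 * T                 ≤⟨ +-monoʳ-≤ (w * (2 * C)) T≤ ⟩
    w * (2 * C) + w * M                    ∎))
    where
    open ≤-Reasoning
    ring : ∀ w C T → 2 * (w * C + 2 * (216 * T + 576 * T)) ≡ w * (2 * C) + 3168 * T
    ring = solve-∀

  module Count {a b₀ W L} (adj : Adjuster a b₀ W) (size≤L : size a b₀ W ≤ L) (0<W : 0 < W) where

    open Adjuster adj
    open ≤-Reasoning

    M : ℕ
    M = 3 ^ L

    private
      e₀ : ∃[ e ] (x₁ + e < 2 ^ a × x₂ + e < 3 ^ b₀ × s₂ (x₁ + e) + s₃ x₂ ≡ s₃ (x₂ + e) + s₂ x₁ + 0)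
      e₀ = adjust 0 0<W

    x₁< : x₁ < 2 ^ a
    x₁< = ≤-<-trans (m≤m+n x₁ _) (proj₁ (proj₂ e₀))
    x₂< : x₂ < 3 ^ b₀
    x₂< = ≤-<-trans (m≤m+n x₂ _) (proj₁ (proj₂ (proj₂ e₀)))

    σ≤a : s₂ x₁ ≤ a
    σ≤a = ≤-trans (Two.s-bound a x₁<) (≤-reflexive (*-identityˡ a))

    τ≤2b₀ : s₃ x₂ ≤ 2 * b₀
    τ≤2b₀ = Three.s-bound b₀ x₂<

    private
      log-a : ∃[ v ] (3 ^ v ≤ 2 ^ a × 2 ^ a < 3 ^ suc v)
      log-a = floorLog (s≤s (s≤s z≤n)) (m^n>0 2 a)
    v : ℕ
    v = proj₁ log-a
    3^v≤2^a : 3 ^ v ≤ 2 ^ a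
    3^v≤2^a = proj₁ (proj₂ log-a)
    2^a<3^1+v : 2 ^ a < 3 ^ suc v
    2^a<3^1+v = proj₂ (proj₂ log-a)

    v≤a : v ≤ a
    v≤a = ^-cancelʳ-≤ 3 (s≤s (s≤s z≤n)) (≤-trans 3^v≤2^a (^-monoˡ-≤ a {2} {3} (s≤s (s≤s z≤n))))

    -- The ternary length comes first, with 3 ^ H₃ between 3 and 9 times 2 ^ a * M. Then `balance`
    -- forces H₂, and b is chosen so that 2 ^ H₂ lies between 3 and 9 times 3 ^ b * M.
    H₃ H₂ : ℕ
    H₃ = L + (v + 2)
    H₂ = (2 * H₃ + 2 * s₃ x₂) ∸ (W + 2 * s₂ x₁)

    balance : H₂ + (W + 2 * s₂ x₁) ≡ 2 * H₃ + 2 * s₃ x₂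
    balance = m∸n+n≡m (begin
      W + 2 * s₂ x₁                      ≤⟨ +-monoʳ-≤ W (*-monoʳ-≤ 2 σ≤a) ⟩
      W + 2 * a                          ≤⟨ m≤m+n _ _ ⟩
      W + 2 * a + (3 * a + 7 * b₀ + 3 * W + 9)  ≡⟨ ring a b₀ W ⟩
      size a b₀ W                        ≤⟨ size≤L ⟩
      L                                  ≤⟨ m≤m+n L _ ⟩
      L + (v + 2)                        ≤⟨ m≤m+n H₃ _ ⟩
      2 * H₃                             ≤⟨ m≤m+n (2 * H₃) _ ⟩
      2 * H₃ + 2 * s₃ x₂                 ∎)
      where
      ring : ∀ a b W → W + 2 * a + (3 * a + 7 * b + 3 * W + 9) ≡ 5 * a + 7 * b + 4 * W + 9
      ring = solve-∀

    H₂≤ : H₂ ≤ 2 * L + (2 * a + 4 * b₀ + 4)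
    H₂≤ = begin
      H₂                                  ≤⟨ m≤m+n H₂ _ ⟩
      H₂ + (W + 2 * s₂ x₁)                ≡⟨ balance ⟩
      2 * H₃ + 2 * s₃ x₂                  ≤⟨ +-mono-≤ (*-monoʳ-≤ 2 (+-monoʳ-≤ L (+-monoˡ-≤ 2 v≤a))) (*-monoʳ-≤ 2 τ≤2b₀) ⟩
      2 * (L + (a + 2)) + 2 * (2 * b₀)    ≡⟨ ring a b₀ L ⟩
      2 * L + (2 * a + 4 * b₀ + 4)        ∎
      where
      ring : ∀ a b L → 2 * (L + (a + 2)) + 2 * (2 * b) ≡ 2 * L + (2 * a + 4 * b + 4)
      ring = solve-∀

    a+H₂≤ : a + H₂ ≤ 2 * L + size a b₀ W
    a+H₂≤ = begin
      a + H₂                                  ≤⟨ +-monoʳ-≤ a H₂≤ ⟩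
      a + (2 * L + (2 * a + 4 * b₀ + 4))      ≤⟨ m≤m+n _ _ ⟩
      a + (2 * L + (2 * a + 4 * b₀ + 4)) + (2 * a + 3 * b₀ + 4 * W + 5)  ≡⟨ ring a b₀ W L ⟩
      2 * L + size a b₀ W                     ∎
      where
      ring : ∀ a b W L → a + (2 * L + (2 * a + 4 * b + 4)) + (2 * a + 3 * b + 4 * W + 5) ≡ 2 * L + (5 * a + 7 * b + 4 * W + 9)
      ring = solve-∀

    H₂≤3L : H₂ ≤ 3 * L
    H₂≤3L = begin
      H₂                       ≤⟨ m≤n+m H₂ a ⟩
      a + H₂                   ≤⟨ a+H₂≤ ⟩
      2 * L + size a b₀ W      ≤⟨ +-monoʳ-≤ (2 * L) size≤L ⟩
      2 * L + L                ≡⟨ +-comm (2 * L) L ⟩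
      3 * L                    ∎

    H₃≤2L : H₃ ≤ 2 * L
    H₃≤2L = begin
      L + (v + 2)              ≤⟨ +-monoʳ-≤ L (+-monoˡ-≤ 2 v≤a) ⟩
      L + (a + 2)              ≤⟨ m≤m+n _ (4 * a + 7 * b₀ + 4 * W + 7) ⟩
      L + (a + 2) + (4 * a + 7 * b₀ + 4 * W + 7)  ≡⟨ ring a b₀ W L ⟩
      L + size a b₀ W          ≤⟨ +-monoʳ-≤ L size≤L ⟩
      L + L                    ≡⟨ cong (L +_) (+-identityʳ L) ⟨
      2 * L                    ∎
      where
      ring : ∀ a b W L → L + (a + 2) + (4 * a + 7 * b + 4 * W + 7) ≡ L + (5 * a + 7 * b + 4 * W + 9)
      ring = solve-∀

    -- Makes room for the ternary digits of the adjuster: by `3^-≤-2^` it gives 3 ^ (L + 1 + b₀) ≤ 2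
    -- ^ H₂, hence b₀ ≤ b.
    H₂≥ : 8 * (L + 1 + b₀) ≤ 5 * H₂
    H₂≥ = +-cancelʳ-≤ (5 * (W + 2 * a)) _ _ (begin
      8 * (L + 1 + b₀) + 5 * (W + 2 * a)                  ≤⟨ m≤m+n _ (6 * b₀ + 3 * W + 30) ⟩
      8 * (L + 1 + b₀) + 5 * (W + 2 * a) + (6 * b₀ + 3 * W + 30)  ≡⟨ ring₁ a b₀ W L ⟩
      8 * L + 2 * size a b₀ W + 20                        ≤⟨ +-monoˡ-≤ 20 (+-monoʳ-≤ (8 * L) (*-monoʳ-≤ 2 size≤L)) ⟩
      8 * L + 2 * L + 20                                  ≤⟨ m≤m+n _ (10 * v + 10 * s₃ x₂) ⟩
      8 * L + 2 * L + 20 + (10 * v + 10 * s₃ x₂)          ≡⟨ ring₂ L v (s₃ x₂) ⟩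
      5 * (2 * H₃ + 2 * s₃ x₂)                            ≡⟨ cong (5 *_) balance ⟨
      5 * (H₂ + (W + 2 * s₂ x₁))                          ≤⟨ *-monoʳ-≤ 5 (+-monoʳ-≤ H₂ (+-monoʳ-≤ W (*-monoʳ-≤ 2 σ≤a))) ⟩
      5 * (H₂ + (W + 2 * a))                              ≡⟨ *-distribˡ-+ 5 H₂ (W + 2 * a) ⟩
      5 * H₂ + 5 * (W + 2 * a)                            ∎)
      where
      ring₁ : ∀ a b W L → 8 * (L + 1 + b) + 5 * (W + 2 * a) + (6 * b + 3 * W + 30) ≡ 8 * L + 2 * (5 * a + 7 * b + 4 * W + 9) + 20
      ring₁ = solve-∀
      ring₂ : ∀ L v τ → 8 * L + 2 * L + 20 + (10 * v + 10 * τ) ≡ 5 * (2 * (L + (v + 2)) + 2 * τ)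
      ring₂ = solve-∀

    private
      log-H₂ : ∃[ d ] (3 ^ d ≤ 2 ^ H₂ × 2 ^ H₂ < 3 ^ suc d)
      log-H₂ = floorLog (s≤s (s≤s z≤n)) (m^n>0 2 H₂)

      L+1+b₀≤ : L + 1 + b₀ ≤ proj₁ log-H₂
      L+1+b₀≤ = s≤s⁻¹ (^-cancelʳ-< 3 (≤-<-trans (3^-≤-2^ {L + 1 + b₀} {H₂} H₂≥) (proj₂ (proj₂ log-H₂))))

    b : ℕ
    b = proj₁ log-H₂ ∸ (L + 1)

    private
      b+1+L≡ : b + (1 + L) ≡ proj₁ log-H₂
      b+1+L≡ = trans (cong (b +_) (+-comm 1 L)) (m∸n+n≡m (≤-trans (m≤m+n (L + 1) b₀) L+1+b₀≤))

    b₀≤b : b₀ ≤ b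
    b₀≤b = +-cancelʳ-≤ (L + 1) _ _ (≤-trans (≤-reflexive (+-comm b₀ (L + 1)))
      (≤-trans L+1+b₀≤ (≤-reflexive (trans (sym b+1+L≡) (cong (b +_) (+-comm 1 L))))))

    3^[b+1+L]≤2^H₂ : 3 * (3 ^ b * M) ≤ 2 ^ H₂
    3^[b+1+L]≤2^H₂ = begin
      3 * (3 ^ b * 3 ^ L)     ≡⟨ ring (3 ^ b) (3 ^ L) ⟩
      3 ^ b * 3 ^ (1 + L)     ≡⟨ ^-distribˡ-+-* 3 b (1 + L) ⟨
      3 ^ (b + (1 + L))       ≡⟨ cong (3 ^_) b+1+L≡ ⟩
      3 ^ proj₁ log-H₂        ≤⟨ proj₁ (proj₂ log-H₂) ⟩
      2 ^ H₂                  ∎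
      where
      ring : ∀ x y → 3 * (x * y) ≡ x * (3 * y)
      ring = solve-∀

    2^H₂≤3^[b+2+L] : 2 ^ H₂ ≤ 9 * (3 ^ b * M)
    2^H₂≤3^[b+2+L] = begin
      2 ^ H₂                       ≤⟨ <⇒≤ (proj₂ (proj₂ log-H₂)) ⟩
      3 * 3 ^ proj₁ log-H₂         ≡⟨ cong (λ d → 3 * 3 ^ d) b+1+L≡ ⟨
      3 * 3 ^ (b + (1 + L))        ≡⟨ cong (3 *_) (^-distribˡ-+-* 3 b (1 + L)) ⟩
      3 * (3 ^ b * (3 * 3 ^ L))    ≡⟨ ring (3 ^ b) (3 ^ L) ⟩
      9 * (3 ^ b * 3 ^ L)          ∎
      where
      ring : ∀ x y → 3 * (x * (3 * y)) ≡ 9 * (x * y)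
      ring = solve-∀

    -- From H₂ ≤ 3 L and 8 ≤ 9. It keeps the difference 3 ^ b of the binary progression below 2 ^ j,
    -- as `progression-moment` requires.
    1+b≤L : 1 + b ≤ L
    1+b≤L = +-cancelʳ-≤ L _ _ (^-cancelʳ-≤ 3 (s≤s (s≤s z≤n)) (begin
      3 ^ (1 + b + L)          ≡⟨ cong (3 *_) (^-distribˡ-+-* 3 b L) ⟩
      3 * (3 ^ b * 3 ^ L)      ≤⟨ 3^[b+1+L]≤2^H₂ ⟩
      2 ^ H₂                   ≤⟨ ^-monoʳ-≤ 2 H₂≤3L ⟩
      2 ^ (3 * L)              ≡⟨ ^-*-assoc 2 3 L ⟨
      8 ^ L                    ≤⟨ ^-monoˡ-≤ L {8} {9} (n≤1+n 8) ⟩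
      9 ^ L                    ≡⟨ ^-*-assoc 3 2 L ⟩
      3 ^ (2 * L)              ≡⟨ cong (λ n → 3 ^ (L + n)) (+-identityʳ L) ⟩
      3 ^ (L + L)              ∎))

    private
      log-M : ∃[ j ] (2 ^ j ≤ M × M < 2 ^ suc j)
      log-M = floorLog (s≤s (s≤s z≤n)) (m^n>0 3 L)
      j : ℕ
      j = proj₁ log-M

    3^b≤2^j : 3 ^ b ≤ 2 ^ j
    3^b≤2^j = <⇒≤ (*-cancelˡ-< 2 (3 ^ b) (2 ^ j) (begin-strict
      2 * 3 ^ b      ≤⟨ *-monoˡ-≤ (3 ^ b) {2} {3} (n≤1+n 2) ⟩
      3 ^ (1 + b)    ≤⟨ ^-monoʳ-≤ 3 1+b≤L ⟩
      3 ^ L          <⟨ proj₂ (proj₂ log-M) ⟩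
      2 * 2 ^ j      ∎))

    private
      j≤H₂ : j ≤ H₂
      j≤H₂ = ^-cancelʳ-≤ 2 (s≤s (s≤s z≤n)) (begin
        2 ^ j                  ≤⟨ proj₁ (proj₂ log-M) ⟩
        M                      ≤⟨ m≤n*m M (3 * 3 ^ b) {{m^n≢0 3 (1 + b)}} ⟩
        3 * 3 ^ b * M          ≡⟨ *-assoc 3 (3 ^ b) M ⟩
        3 * (3 ^ b * M)        ≤⟨ 3^[b+1+L]≤2^H₂ ⟩
        2 ^ H₂                 ∎)

      r : ℕ
      r = H₂ ∸ j
      j+r≡H₂ : j + r ≡ H₂
      j+r≡H₂ = m+[n∸m]≡n j≤H₂

    moment₂ : ∀ {X} → X < 3 ^ b → ∑ M (λ u → sq (Moment₂.dev H₂ (s₂ (X + u * 3 ^ b)))) ≤ 216 * (L * M)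
    moment₂ {X} X< = begin
      ∑ M (λ u → sq (Moment₂.dev H₂ (s₂ (X + u * 3 ^ b))))       ≡⟨ cong (λ h → ∑ M (λ u → sq (Moment₂.dev h (s₂ (X + u * 3 ^ b))))) j+r≡H₂ ⟨
      ∑ M (λ u → sq (Moment₂.dev (j + r) (s₂ (X + u * 3 ^ b))))  ≤⟨ Progression.progression-moment 2 2 digit-moment₂ j r X< 3^b≤2^j (proj₁ (proj₂ log-M))
                                                                      (subst (λ h → 3 * (3 ^ b * M) ≤ 2 ^ h) (sym j+r≡H₂) 3^[b+1+L]≤2^H₂)
                                                                      (subst (λ h → 2 ^ h ≤ 9 * (3 ^ b * M)) (sym j+r≡H₂) 2^H₂≤3^[b+2+L])
                                                                      (coprime-sym (coprime-^ b (coprime-sym 2⊥3))) ⟩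
      72 * (j + r) * M       ≡⟨ cong (λ h → 72 * h * M) j+r≡H₂ ⟩
      72 * H₂ * M            ≤⟨ *-monoˡ-≤ M (*-monoʳ-≤ 72 H₂≤3L) ⟩
      72 * (3 * L) * M       ≡⟨ ring L M ⟩
      216 * (L * M)          ∎
      where
      ring : ∀ L M → 72 * (3 * L) * M ≡ 216 * (L * M)
      ring = solve-∀

    moment₃ : ∀ {X} → X < 2 ^ a → ∑ M (λ u → sq (Moment₃.dev H₃ (s₃ (X + u * 2 ^ a)))) ≤ 576 * (L * M)
    moment₃ {X} X< = begin
      ∑ M (λ u → sq (Moment₃.dev H₃ (s₃ (X + u * 2 ^ a))))  ≤⟨ Progression.progression-moment 3 8 digit-moment₃ L (v + 2) X< 2^a≤M ≤-refl lower upper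
                                                                 (coprime-sym (coprime-^ a 2⊥3)) ⟩
      288 * H₃ * M           ≤⟨ *-monoˡ-≤ M (*-monoʳ-≤ 288 H₃≤2L) ⟩
      288 * (2 * L) * M      ≡⟨ ring L M ⟩
      576 * (L * M)          ∎
      where
      ring : ∀ L M → 288 * (2 * L) * M ≡ 576 * (L * M)
      ring = solve-∀
      a≤L : a ≤ L
      a≤L = ≤-trans (≤-trans (m≤m+n a (4 * a + 7 * b₀ + 4 * W + 9)) (≤-reflexive (ring′ a b₀ W))) size≤L
        where
        ring′ : ∀ a b W → a + (4 * a + 7 * b + 4 * W + 9) ≡ 5 * a + 7 * b + 4 * W + 9
        ring′ = solve-∀
      2^a≤M : 2 ^ a ≤ 3 ^ L
      2^a≤M = ≤-trans (^-monoˡ-≤ a {2} {3} (n≤1+n 2)) (^-monoʳ-≤ 3 a≤L)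
      H₃-power : 3 ^ H₃ ≡ 9 * (3 ^ v * M)
      H₃-power = trans (^-distribˡ-+-* 3 L (v + 2)) (trans (cong (3 ^ L *_) (^-distribˡ-+-* 3 v 2)) (ring′ (3 ^ L) (3 ^ v)))
        where
        ring′ : ∀ x y → x * (y * 9) ≡ 9 * (y * x)
        ring′ = solve-∀
      lower : 3 * (2 ^ a * M) ≤ 3 ^ H₃
      lower = begin
        3 * (2 ^ a * M)        ≤⟨ *-monoʳ-≤ 3 (*-monoˡ-≤ M (<⇒≤ 2^a<3^1+v)) ⟩
        3 * (3 * 3 ^ v * M)    ≡⟨ ring′ (3 ^ v) M ⟩
        9 * (3 ^ v * M)        ≡⟨ H₃-power ⟨
        3 ^ H₃                 ∎
        where
        ring′ : ∀ x y → 3 * (3 * x * y) ≡ 9 * (x * y)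
        ring′ = solve-∀
      upper : 3 ^ H₃ ≤ 9 * (2 ^ a * M)
      upper = ≤-trans (≤-reflexive H₃-power) (*-monoʳ-≤ 9 (*-monoˡ-≤ M 3^v≤2^a))

    2MG≤ : 2 * (M * (2 ^ a * 3 ^ b)) ≤ 2 ^ (2 * L + size a b₀ W)
    2MG≤ = begin
      2 * (M * (2 ^ a * 3 ^ b))      ≡⟨ ring M (2 ^ a) (3 ^ b) ⟩
      2 ^ a * (2 * (3 ^ b * M))      ≤⟨ *-monoʳ-≤ (2 ^ a) (*-monoˡ-≤ (3 ^ b * M) {2} {3} (n≤1+n 2)) ⟩
      2 ^ a * (3 * (3 ^ b * M))      ≤⟨ *-monoʳ-≤ (2 ^ a) 3^[b+1+L]≤2^H₂ ⟩
      2 ^ a * 2 ^ H₂                 ≡⟨ ^-distribˡ-+-* 2 a H₂ ⟨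
      2 ^ (a + H₂)                   ≤⟨ ^-monoʳ-≤ 2 a+H₂≤ ⟩
      2 ^ (2 * L + size a b₀ W)      ∎
      where
      ring : ∀ M x y → 2 * (M * (x * y)) ≡ x * (2 * (y * M))
      ring = solve-∀

    count : 3168 * L ≤ W * W → 3 ^ L ≤ 2 * collisions (2 ^ (2 * L + size a b₀ W))
    count 3168L≤W² = markov {W * W} {M} {_} {L * M} {{m*n≢0 W W}}
      (many M 2MG≤)
      (≤-trans (≤-reflexive (∑-distrib-+ M (λ u → sq (Moment₂.dev H₂ (A u))) (λ u → sq (Moment₃.dev H₃ (B u))))) (+-mono-≤ (moment₂ X₁<) (moment₃ X₂<)))
      (≤-trans (≤-reflexive (sym (*-assoc 3168 L M))) (*-monoˡ-≤ M 3168L≤W²))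
      where
      instance
        W≢0 : NonZero W
        W≢0 = >-nonZero 0<W
      crt : ∃[ X₁ ] ∃[ X₂ ] (X₁ < 3 ^ b × X₂ < 2 ^ a × x₁ + X₁ * 2 ^ a ≡ x₂ + X₂ * 3 ^ b)
      crt = chinese-remainder (coprime-^ a (coprime-sym (coprime-^ b (coprime-sym 2⊥3)))) x₁< (<-≤-trans x₂< (^-monoʳ-≤ 3 b₀≤b))
      X₁ X₂ : ℕ
      X₁ = proj₁ crt
      X₂ = proj₁ (proj₂ crt)
      X₁< : X₁ < 3 ^ b
      X₁< = proj₁ (proj₂ (proj₂ crt))
      X₂< : X₂ < 2 ^ a
      X₂< = proj₁ (proj₂ (proj₂ (proj₂ crt)))
      -- The digits of `x₂` in places b₀ to b - 1 are the zeros that lower the ternary mean; the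
      -- correction stays below them.
      adjust-b : ∀ D → D < W → ∃[ e ] (x₁ + e < 2 ^ a × x₂ + e < 3 ^ b × s₂ (x₁ + e) + s₃ x₂ ≡ s₃ (x₂ + e) + s₂ x₁ + D)
      adjust-b D D<W = let e , e₁ , e₂ , eq = adjust D D<W in e , e₁ , <-≤-trans e₂ (^-monoʳ-≤ 3 b₀≤b) , eq
      open Adjusted {a} {b} {W} {x₁} {x₂} {X₁} {X₂} {H₂} {H₃} adjust-b X₁< x₁< (proj₂ (proj₂ (proj₂ (proj₂ crt)))) balance

  -- Size of an adjuster compared with its range

  Bernoulli-27 : ∀ w → 27 ^ w * (27 + w) ≤ 27 * 28 ^ w
  Bernoulli-27 zero = ≤-refl
  Bernoulli-27 (suc w) = begin
    27 ^ suc w * (27 + suc w)               ≤⟨ m≤m+n _ (27 ^ w * w) ⟩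
    27 ^ suc w * (27 + suc w) + 27 ^ w * w  ≡⟨ ring (27 ^ w) w ⟩
    28 * (27 ^ w * (27 + w))                ≤⟨ *-monoʳ-≤ 28 (Bernoulli-27 w) ⟩
    28 * (27 * 28 ^ w)                      ≡⟨ swap (28 ^ w) ⟩
    27 * 28 ^ suc w                         ∎
    where
    open ≤-Reasoning
    ring : ∀ p w → 27 * p * (27 + suc w) + p * w ≡ 28 * (p * (27 + w))
    ring = solve-∀
    swap : ∀ p → 28 * (27 * p) ≡ 27 * (28 * p)
    swap = solve-∀

  -- 28/27 is the ratio of 4 to the growth rate 27/7 of `size`; its powers outgrow any constant c.
  c*27^w≤28^w : ∀ c {w} → 27 * c ≤ w → c * 27 ^ w ≤ 28 ^ w
  c*27^w≤28^w c {w} 27c≤w = *-cancelˡ-≤ 27 (begin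
    27 * (c * 27 ^ w)        ≡⟨ ring c (27 ^ w) ⟩
    27 ^ w * (27 * c)        ≤⟨ *-monoʳ-≤ (27 ^ w) (≤-trans 27c≤w (m≤n+m w 27)) ⟩
    27 ^ w * (27 + w)        ≤⟨ Bernoulli-27 w ⟩
    27 * 28 ^ w              ∎)
    where
    open ≤-Reasoning
    ring : ∀ c p → 27 * (c * p) ≡ p * (27 * c)
    ring = solve-∀

  ^-distribʳ-* : ∀ k m n → (m * n) ^ k ≡ m ^ k * n ^ k
  ^-distribʳ-* zero    m n = refl
  ^-distribʳ-* (suc k) m n = trans (cong (m * n *_) (^-distribʳ-* k m n)) (interchange m n (m ^ k) (n ^ k))
    where
    interchange : ∀ m n p r → m * n * (p * r) ≡ m * p * (n * r)
    interchange = solve-∀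

  -- Kept opaque so that multiplication by this literal is never unrolled.
  opaque
    4^7 : ℕ
    4^7 = 4 ^ 7

    4^7≢0 : NonZero 4^7
    4^7≢0 = _

    4^7-power : ∀ v → 4 ^ (7 + v) ≡ 4^7 * 4 ^ v
    4^7-power v = ^-distribˡ-+-* 4 7 v

    range-bound : ∀ {n v} → n < 4 ^ suc v → 3168 * n ≤ 4 ^ (7 + v)
    range-bound {n} {v} n< = begin
      3168 * n                   ≤⟨ *-mono-≤ {3168} {4096} (m≤m+n 3168 928) (<⇒≤ n<) ⟩
      4096 * 4 ^ suc v           ≡⟨ ^-distribˡ-+-* 4 6 (suc v) ⟨
      4 ^ (6 + suc v)            ≡⟨ cong (4 ^_) (+-suc 6 v) ⟩
      4 ^ (7 + v)                ∎
      where open ≤-Reasoning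

  -- The exponent is 27 c for c = k * (`4^7` * 13), from which on `c*27^w≤28^w` applies. Here 13
  -- comes from `adjuster`, `4^7` from rounding W ² up to a power of 4, and k from the demand that
  -- the size be at most a k-th of L = k l.
  threshold : ℕ → ℕ
  threshold k = 4 ^ (27 * (k * (4^7 * 13)))

  small-adjuster : ∀ k l → 1 ≤ k → threshold k ≤ l →
    ∃[ a ] ∃[ b ] ∃[ W ] (Adjuster a b W × 0 < W × size a b W ≤ l × 3168 * (k * l) ≤ W * W)
  small-adjuster k l 1≤k l₀≤l = a , b , 2 ^ w , adj , m^n>0 2 w , size≤l , range
    where
    open ≤-Reasoning
    log-L : ∃[ v ] (4 ^ v ≤ k * l × k * l < 4 ^ suc v)
    log-L = floorLog (s≤s (s≤s z≤n)) (*-mono-≤ 1≤k (≤-trans (m^n>0 4 (27 * (k * (4^7 * 13)))) l₀≤l))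
    v w : ℕ
    v = proj₁ log-L
    -- 4 ^ v ≤ k l < 4 ^ (v + 1) and 3168 ≤ 4 ^ 6 place W ² = 4 ^ w between 3168 k l and 4 ^ 7 k l.
    w = 7 + v
    4^v≤L : 4 ^ v ≤ k * l
    4^v≤L = proj₁ (proj₂ log-L)
    L<4^1+v : k * l < 4 ^ suc v
    L<4^1+v = proj₂ (proj₂ log-L)

    family : ∃[ a ] ∃[ b ] (Adjuster a b (2 ^ w) × 7 ^ w * size a b (2 ^ w) ≤ 13 * 27 ^ w)
    family = adjuster w
    a b : ℕ
    a = proj₁ family
    b = proj₁ (proj₂ family)
    adj : Adjuster a b (2 ^ w)
    adj = proj₁ (proj₂ (proj₂ family))
    size≤ : 7 ^ w * size a b (2 ^ w) ≤ 13 * 27 ^ w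
    size≤ = proj₂ (proj₂ (proj₂ family))

    instance
      k≢0 : NonZero k
      k≢0 = >-nonZero 1≤k

    27c≤w : 27 * (k * (4^7 * 13)) ≤ w
    27c≤w = ≤-trans (s≤s⁻¹ (^-cancelʳ-< 4 (≤-<-trans l₀≤l (≤-<-trans (m≤n*m l k) L<4^1+v)))) (m≤n+m v 7)

    size≤l : size a b (2 ^ w) ≤ l
    size≤l = *-cancelˡ-≤ (k * (4^7 * 7 ^ w)) {{m*n≢0 k (4^7 * 7 ^ w) {{k≢0}} {{m*n≢0 4^7 (7 ^ w) {{4^7≢0}} {{m^n≢0 7 w}}}}}} (begin
      k * (4^7 * 7 ^ w) * size a b (2 ^ w)       ≡⟨ ring₁ k 4^7 (7 ^ w) (size a b (2 ^ w)) ⟩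
      k * 4^7 * (7 ^ w * size a b (2 ^ w))     ≤⟨ *-monoʳ-≤ (k * 4^7) size≤ ⟩
      k * 4^7 * (13 * 27 ^ w)                  ≡⟨ ring₂ k 4^7 13 (27 ^ w) ⟩
      k * (4^7 * 13) * 27 ^ w                    ≤⟨ c*27^w≤28^w (k * (4^7 * 13)) 27c≤w ⟩
      28 ^ w                                       ≡⟨ ^-distribʳ-* w 7 4 ⟩
      7 ^ w * 4 ^ (7 + v)                          ≡⟨ cong (7 ^ w *_) (4^7-power v) ⟩
      7 ^ w * (4^7 * 4 ^ v)                      ≤⟨ *-monoʳ-≤ (7 ^ w) (*-monoʳ-≤ 4^7 4^v≤L) ⟩
      7 ^ w * (4^7 * (k * l))                    ≡⟨ ring₃ (7 ^ w) 4^7 k l ⟩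
      k * (4^7 * 7 ^ w) * l                      ∎)
      where
      ring₁ : ∀ k f s z → k * (f * s) * z ≡ k * f * (s * z)
      ring₁ = solve-∀
      ring₂ : ∀ k f t p → k * f * (t * p) ≡ k * (f * t) * p
      ring₂ = solve-∀
      ring₃ : ∀ s f k l → s * (f * (k * l)) ≡ k * (f * s) * l
      ring₃ = solve-∀

    range : 3168 * (k * l) ≤ 2 ^ w * 2 ^ w
    range = ≤-trans (range-bound {k * l} {v} L<4^1+v) (≤-reflexive (^-distribʳ-* w 2 2))

  -- Lower bounds for the number of collisions

  collisions-at-powers : ∀ k l → 1 ≤ k → threshold k ≤ l → 3 ^ (k * l) ≤ 2 * collisions ((2 ^ (1 + 2 * k)) ^ l)
  collisions-at-powers k l 1≤k l₀≤l
    = let a , b , W , adj , 0<W , size≤l , range = small-adjuster k l 1≤k l₀≤l in ≤-trans (Count.count adj (≤-trans size≤l (m≤n*m l k {{>-nonZero 1≤k}})) 0<W range)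
        (*-monoʳ-≤ 2 (collisions-mono (begin
          2 ^ (2 * (k * l) + size a b W)   ≤⟨ ^-monoʳ-≤ 2 (+-monoʳ-≤ (2 * (k * l)) size≤l) ⟩
          2 ^ (2 * (k * l) + l)            ≡⟨ cong (2 ^_) (ring k l) ⟩
          2 ^ ((1 + 2 * k) * l)            ≡⟨ ^-*-assoc 2 (1 + 2 * k) l ⟨
          (2 ^ (1 + 2 * k)) ^ l            ∎)))
    where
    open ≤-Reasoning
    ring : ∀ k l → 2 * (k * l) + l ≡ (1 + 2 * k) * l
    ring = solve-∀

  -- The density bound without real exponents: eliminating L gives at least N ^ ((log 3 / log 4) k /
  -- (k + 1)) / C collisions. Passing from powers of Q to all N costs the constant 3 ^ k, and below
  -- the threshold the collision at 0 suffices.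
  collisions-lower-bound : ∀ k → 1 ≤ k → ∃[ C ] (1 ≤ C ×
    ∀ N → 1 ≤ N → ∃[ L ] (1 ≤ L × N ^ k ≤ 4 ^ (suc k * L) × 3 ^ L ≤ C * collisions N))
  collisions-lower-bound k 1≤k = C , ≤-trans (m^n>0 3 (k * l₀)) (m≤m+n (3 ^ (k * l₀)) _) , bound
    where
    open ≤-Reasoning
    l₀ Q C : ℕ
    l₀ = threshold k
    Q = 2 ^ (1 + 2 * k)
    C = 3 ^ (k * l₀) + 3 ^ k * 2

    1≤l₀ : 1 ≤ l₀
    1≤l₀ = m^n>0 4 (27 * (k * (4^7 * 13)))

    1<Q : 1 < Q
    1<Q = ^-monoʳ-< 2 (s≤s (s≤s z≤n)) {0} {1 + 2 * k} (s≤s z≤n)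

    power : ∀ {N} l → N ≤ Q ^ l → N ^ k ≤ 4 ^ (suc k * (k * l))
    power {N} l N≤ = begin
      N ^ k                          ≤⟨ ^-monoˡ-≤ k N≤ ⟩
      (Q ^ l) ^ k                    ≡⟨ trans (^-*-assoc Q l k) (^-*-assoc 2 (1 + 2 * k) (l * k)) ⟩
      2 ^ ((1 + 2 * k) * (l * k))    ≤⟨ ^-monoʳ-≤ 2 (m≤m+n ((1 + 2 * k) * (l * k)) (l * k)) ⟩
      2 ^ ((1 + 2 * k) * (l * k) + l * k)  ≡⟨ cong (2 ^_) (ring k l) ⟩
      2 ^ (2 * (suc k * (k * l)))    ≡⟨ ^-*-assoc 2 2 (suc k * (k * l)) ⟨
      4 ^ (suc k * (k * l))          ∎
      where
      ring : ∀ k l → (1 + 2 * k) * (l * k) + l * k ≡ 2 * (suc k * (k * l))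
      ring = solve-∀

    bound : ∀ N → 1 ≤ N → ∃[ L ] (1 ≤ L × N ^ k ≤ 4 ^ (suc k * L) × 3 ^ L ≤ C * collisions N)
    bound N 1≤N with l , Q^l≤N , N<Q^1+l ← floorLog 1<Q 1≤N with l₀ ≤? l
    ... | yes l₀≤l = k * suc l , *-mono-≤ 1≤k (s≤s z≤n) , power (suc l) (<⇒≤ N<Q^1+l) , (begin
      3 ^ (k * suc l)                        ≡⟨ trans (cong (3 ^_) (*-suc k l)) (^-distribˡ-+-* 3 k (k * l)) ⟩
      3 ^ k * 3 ^ (k * l)                    ≤⟨ *-monoʳ-≤ (3 ^ k) (collisions-at-powers k l 1≤k l₀≤l) ⟩
      3 ^ k * (2 * collisions (Q ^ l))       ≡⟨ *-assoc (3 ^ k) 2 _ ⟨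
      3 ^ k * 2 * collisions (Q ^ l)         ≤⟨ *-mono-≤ (m≤n+m (3 ^ k * 2) (3 ^ (k * l₀))) (collisions-mono Q^l≤N) ⟩
      C * collisions N                       ∎)
    ... | no l₀≰l = k * l₀ , *-mono-≤ 1≤k 1≤l₀ , power l₀ (≤-trans (<⇒≤ N<Q^1+l) (^-monoʳ-≤ Q {{>-nonZero (<-trans z<s 1<Q)}} (≰⇒> l₀≰l))) , (begin
      3 ^ (k * l₀)                           ≤⟨ m≤m+n (3 ^ (k * l₀)) (3 ^ k * 2) ⟩
      C                                      ≡⟨ *-identityʳ C ⟨
      C * 1                                  ≤⟨ *-monoʳ-≤ C (collisions-mono 1≤N) ⟩
      C * collisions N                       ∎)

  -- Infinitely many collisions

  collisions≤ : ∀ N → collisions N ≤ N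
  collisions≤ N = ≤-trans (length-filter collides? (upTo N)) (≤-reflexive (length-upTo N))

  -- At most m collisions lie below m, so the largest of more than m collisions is at least m; it is
  -- found by descending from N.
  collision-beyond : ∀ m N → m < collisions N → ∃[ n ] (n ≥ m × digitSum 2 n ≡ digitSum 3 n)
  collision-beyond m (suc N) m<c with collides? N | m ≤? N
  ... | yes eq | yes m≤N = N , m≤N , eq
  ... | yes eq | no m≰N = ⊥-elim (<⇒≱ m<c (≤-trans (collisions≤ (suc N)) (≰⇒> m≰N)))
  ... | no ≢ | _ = collision-beyond m N (subst (m <_) (begin
      collisions (suc N)             ≡⟨ ∑-collision (suc N) ⟨
      ∑ N collision + collision N    ≡⟨ cong₂ _+_ (∑-collision N) (cong length (filter-reject collides? {N} {[]} ≢)) ⟩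
      collisions N + 0               ≡⟨ +-identityʳ (collisions N) ⟩
      collisions N                   ∎) m<c)
    where open ≡-Reasoning

  infinitely-many : ∀ m → ∃[ n ] (n ≥ m × digitSum 2 n ≡ digitSum 3 n)
  infinitely-many m with C , 1≤C , bound ← collisions-lower-bound 1 ≤-refl
    -- For k = 1 and this N, the bound N ≤ 4 ^ (2 L) forces C m ≤ L < 3 ^ L ≤ C * `collisions` N.
    with L , _ , N≤ , 3^L≤ ← bound (4 ^ (2 * (C * m))) (m^n>0 4 (2 * (C * m)))
    = collision-beyond m (4 ^ (2 * (C * m))) (*-cancelˡ-< C m _ (begin-strict
      C * m          ≤⟨ *-cancelˡ-≤ 2 (^-cancelʳ-≤ 4 (s≤s (s≤s z≤n)) (≤-trans (≤-reflexive (sym (*-identityʳ _))) N≤)) ⟩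
      L              <⟨ n<3^n L ⟩
      3 ^ L          ≤⟨ 3^L≤ ⟩
      C * collisions (4 ^ (2 * (C * m)))  ∎))
    where
    open ≤-Reasoning
    n<3^n : ∀ n → n < 3 ^ n
    n<3^n zero = s≤s z≤n
    n<3^n (suc n) = begin-strict
      suc n              ≤⟨ n<3^n n ⟩
      3 ^ n              <⟨ m<m+n (3 ^ n) (≤-trans (m^n>0 3 n) (m≤m+n (3 ^ n) _)) ⟩
      3 * 3 ^ n          ∎

open import Defs
open import Algebra.Bundles using (CommutativeRing)
open import Algebra.Definitions.RawSemiring using () renaming (_^_ to pow)
import Algebra.Properties.CommutativeSemiring.Exp as Exp
open import Data.Empty using (⊥-elim)
open import Data.Integer.Base as ℤ using (+[1+_])
import Data.Integer.Properties as ℤ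
open import Data.Nat.Base as ℕ using (ℕ; zero; suc; _≥_)
import Data.Nat.Properties as ℕ
open import Data.Product.Base using (_×_; _,_; ∃-syntax)
open import Data.Rational.Base hiding (_≥_)
open import Data.Rational.Properties
open import Data.Rational.Solver using (module +-*-Solver)
open import Data.Rational.Unnormalised.Base as ℚᵘ using (mkℚᵘ; *≡*)
import Data.Rational.Unnormalised.Properties as ℚᵘ
open import Data.Sum.Base using (_⊎_; inj₁; inj₂)
open import Relation.Binary.Definitions using (tri<; tri≈; tri>)
open import Relation.Binary.PropositionalEquality
  using (_≡_; refl; sym; trans; cong; cong₂; subst; subst₂; module ≡-Reasoning)
open import Relation.Nullary.Decidable using (Dec; yes; no)
open Counting using (infinitely-many; collisions-lower-bound)
open +-*-Solver using (solve; _:=_; _:+_; _:*_; :-_; _:-_; con)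
open Exp (CommutativeRing.commutativeSemiring +-*-commutativeRing) using (^-assocʳ; ^-distrib-*)

-- Rational powers and the embedding of the natural numbers

infixr 8 _^ℚ_
_^ℚ_ : ℚ → ℕ → ℚ
x ^ℚ n = pow +-*-rawSemiring x n

0≤1 : 0ℚ ≤ 1ℚ
0≤1 = *≤* (ℤ.+≤+ ℕ.z≤n)

0<1 : 0ℚ < 1ℚ
0<1 = *<* (ℤ.+<+ (ℕ.s≤s ℕ.z≤n))

*-monoˡ : ∀ {p q r} → 0ℚ ≤ r → p ≤ q → r * p ≤ r * q
*-monoˡ {r = r} 0≤r = *-monoˡ-≤-nonNeg r {{nonNegative 0≤r}}

*-monoʳ : ∀ {p q r} → 0ℚ ≤ r → p ≤ q → p * r ≤ q * r
*-monoʳ {r = r} 0≤r = *-monoʳ-≤-nonNeg r {{nonNegative 0≤r}}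

*-mono-nonNeg : ∀ {p q r s} → 0ℚ ≤ q → 0ℚ ≤ r → p ≤ q → r ≤ s → p * r ≤ q * s
*-mono-nonNeg 0≤q 0≤r p≤q r≤s = ≤-trans (*-monoʳ 0≤r p≤q) (*-monoˡ 0≤q r≤s)

*-monoˡ-< : ∀ {p q r} → 0ℚ < r → p < q → r * p < r * q
*-monoˡ-< {r = r} 0<r = *-monoʳ-<-pos r {{positive 0<r}}

*-monoʳ-< : ∀ {p q r} → 0ℚ < r → p < q → p * r < q * r
*-monoʳ-< {r = r} 0<r = *-monoˡ-<-pos r {{positive 0<r}}

0≤* : ∀ {p q} → 0ℚ ≤ p → 0ℚ ≤ q → 0ℚ ≤ p * q
0≤* {p} {q} 0≤p 0≤q = subst (_≤ p * q) (*-zeroʳ p) (*-monoˡ 0≤p 0≤q)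

0<* : ∀ {p q} → 0ℚ < p → 0ℚ < q → 0ℚ < p * q
0<* {p} {q} 0<p 0<q = subst (_< p * q) (*-zeroʳ p) (*-monoˡ-< 0<p 0<q)

*-nonNeg-nonPos : ∀ {p q} → 0ℚ ≤ p → q ≤ 0ℚ → p * q ≤ 0ℚ
*-nonNeg-nonPos {p} {q} 0≤p q≤0 = subst (p * q ≤_) (*-zeroʳ p) (*-monoˡ 0≤p q≤0)

*-cancelˡ-0< : ∀ {p q} → 0ℚ < p → 0ℚ < p * q → 0ℚ < q
*-cancelˡ-0< {p} {q} 0<p 0<pq = *-cancelˡ-<-nonNeg p {{nonNegative (<⇒≤ 0<p)}} (subst (_< p * q) (sym (*-zeroʳ p)) 0<pq)

*-cancelʳ-0< : ∀ {p q} → 0ℚ < q → 0ℚ < p * q → 0ℚ < p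
*-cancelʳ-0< {p} {q} 0<q 0<pq = *-cancelˡ-0< 0<q (subst (0ℚ <_) (*-comm p q) 0<pq)

p≤p+q : ∀ p {q} → 0ℚ ≤ q → p ≤ p + q
p≤p+q p {q} 0≤q = subst (_≤ p + q) (+-identityʳ p) (+-monoʳ-≤ p 0≤q)

0≤x² : ∀ x → 0ℚ ≤ x * x
0≤x² x with ≤-total 0ℚ x
... | inj₁ 0≤x = 0≤* 0≤x 0≤x
... | inj₂ x≤0 = subst (0ℚ ≤_) (solve 1 (λ x → (:- x) :* (:- x) := x :* x) refl x) (0≤* 0≤-x 0≤-x)
  where
  0≤-x : 0ℚ ≤ - x
  0≤-x = neg-antimono-≤ x≤0

0<pow : ∀ {x} n → 0ℚ < x → 0ℚ < x ^ℚ n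
0<pow zero    _   = 0<1
0<pow (suc n) 0<x = 0<* 0<x (0<pow n 0<x)

0≤pow : ∀ {x} n → 0ℚ ≤ x → 0ℚ ≤ x ^ℚ n
0≤pow zero    _   = 0≤1
0≤pow (suc n) 0≤x = 0≤* 0≤x (0≤pow n 0≤x)

pow-mono-≤ : ∀ {x y} n → 0ℚ ≤ x → x ≤ y → x ^ℚ n ≤ y ^ℚ n
pow-mono-≤ zero    _   _   = ≤-refl
pow-mono-≤ (suc n) 0≤x x≤y = *-mono-nonNeg (≤-trans 0≤x x≤y) (0≤pow n 0≤x) x≤y (pow-mono-≤ n 0≤x x≤y)

pow-mono-< : ∀ {x y} n → 0ℚ ≤ x → x < y → x ^ℚ suc n < y ^ℚ suc n
pow-mono-< {x} {y} n 0≤x x<y = ≤-<-trans (*-monoˡ 0≤x (pow-mono-≤ n 0≤x (<⇒≤ x<y)))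
  (*-monoʳ-< (0<pow n (≤-<-trans 0≤x x<y)) x<y)

pow-1 : ∀ n → 1ℚ ^ℚ n ≡ 1ℚ
pow-1 zero    = refl
pow-1 (suc n) = trans (*-identityˡ (1ℚ ^ℚ n)) (pow-1 n)

ι : ℕ → ℚ
ι n = ℤ.+ n / 1

recip : ℕ → ℚ
recip k = ℤ.+ 1 / suc k

fromℚᵘ-homo-* : ∀ p q → fromℚᵘ p * fromℚᵘ q ≡ fromℚᵘ (p ℚᵘ.* q)
fromℚᵘ-homo-* p q = toℚᵘ-injective (ℚᵘ.≃-trans (toℚᵘ-homo-* (fromℚᵘ p) (fromℚᵘ q))
  (ℚᵘ.≃-trans (ℚᵘ.*-cong (toℚᵘ-fromℚᵘ p) (toℚᵘ-fromℚᵘ q)) (ℚᵘ.≃-sym (toℚᵘ-fromℚᵘ (p ℚᵘ.* q)))))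

fromℚᵘ-homo-+ : ∀ p q → fromℚᵘ p + fromℚᵘ q ≡ fromℚᵘ (p ℚᵘ.+ q)
fromℚᵘ-homo-+ p q = toℚᵘ-injective (ℚᵘ.≃-trans (toℚᵘ-homo-+ (fromℚᵘ p) (fromℚᵘ q))
  (ℚᵘ.≃-trans (ℚᵘ.+-cong (toℚᵘ-fromℚᵘ p) (toℚᵘ-fromℚᵘ q)) (ℚᵘ.≃-sym (toℚᵘ-fromℚᵘ (p ℚᵘ.+ q)))))

ι-suc : ∀ n → ι (suc n) ≡ 1ℚ + ι n
ι-suc n = sym (trans (fromℚᵘ-homo-+ (mkℚᵘ (ℤ.+ 1) 0) (mkℚᵘ (ℤ.+ n) 0))
  (cong (λ z → fromℚᵘ (mkℚᵘ (ℤ.+ 1 ℤ.+ z) 0)) (ℤ.*-identityʳ (ℤ.+ n))))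

ι-* : ∀ m n → ι (m ℕ.* n) ≡ ι m * ι n
ι-* m n = trans (cong (λ z → fromℚᵘ (mkℚᵘ z 0)) (ℤ.pos-* m n)) (sym (fromℚᵘ-homo-* (mkℚᵘ (ℤ.+ m) 0) (mkℚᵘ (ℤ.+ n) 0)))

ι-^ : ∀ m n → ι (m ℕ.^ n) ≡ ι m ^ℚ n
ι-^ m zero    = refl
ι-^ m (suc n) = trans (ι-* m (m ℕ.^ n)) (cong (ι m *_) (ι-^ m n))

0≤ι : ∀ n → 0ℚ ≤ ι n
0≤ι zero    = ≤-refl
0≤ι (suc n) = subst (0ℚ ≤_) (sym (ι-suc n)) (≤-trans (0≤ι n) (subst (_≤ 1ℚ + ι n) (+-identityˡ (ι n)) (+-monoˡ-≤ (ι n) 0≤1)))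

ι-mono : ∀ {m n} → m ℕ.≤ n → ι m ≤ ι n
ι-mono {zero}  {n}     _           = 0≤ι n
ι-mono {suc m} {suc n} (ℕ.s≤s m≤n) = subst₂ _≤_ (sym (ι-suc m)) (sym (ι-suc n)) (+-monoʳ-≤ 1ℚ (ι-mono m≤n))

0<ι : ∀ {n} → 1 ℕ.≤ n → 0ℚ < ι n
0<ι 1≤n = <-≤-trans 0<1 (ι-mono 1≤n)

ι*recip : ∀ k → ι (suc k) * recip k ≡ 1ℚ
ι*recip k = trans (fromℚᵘ-homo-* (mkℚᵘ (ℤ.+ suc k) 0) (mkℚᵘ (ℤ.+ 1) k)) (fromℚᵘ-cong {mkℚᵘ (ℤ.+ suc k) 0 ℚᵘ.* mkℚᵘ (ℤ.+ 1) k} {mkℚᵘ (ℤ.+ 1) 0}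
  (*≡* (trans (ℤ.*-identityʳ _) (trans (ℤ.*-identityʳ (ℤ.+ suc k)) (sym (trans (ℤ.*-identityˡ _) (cong (λ n → ℤ.+ suc n) (ℕ.+-identityʳ k))))))))

0≤recip : ∀ k → 0ℚ ≤ recip k
0≤recip k = nonNegative⁻¹ (recip k) {{normalize-nonNeg 1 (suc k)}}

recip-* : ∀ k l → recip k * recip l ≡ recip (l ℕ.+ k ℕ.* suc l)
recip-* k l = fromℚᵘ-homo-* (mkℚᵘ (ℤ.+ 1) k) (mkℚᵘ (ℤ.+ 1) l)

-- Rational bounds for the exponential function

1+-nonNeg : ∀ n {t} → 0ℚ < 1ℚ + ι (suc n) * t → 0ℚ ≤ 1ℚ + t
1+-nonNeg n {t} 0< with ≤-total 0ℚ t
... | inj₁ 0≤t = ≤-trans 0≤1 (p≤p+q 1ℚ 0≤t)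
... | inj₂ t≤0 = ≤-trans (<⇒≤ 0<) (begin
  1ℚ + ι (suc n) * t          ≡⟨ cong (λ x → 1ℚ + x * t) (ι-suc n) ⟩
  1ℚ + (1ℚ + ι n) * t         ≡⟨ solve 2 (λ i t → con 1ℚ :+ (con 1ℚ :+ i) :* t := (con 1ℚ :+ t) :+ i :* t) refl (ι n) t ⟩
  1ℚ + t + ι n * t            ≤⟨ +-monoʳ-≤ (1ℚ + t) (*-nonNeg-nonPos (0≤ι n) t≤0) ⟩
  1ℚ + t + 0ℚ                 ≡⟨ +-identityʳ (1ℚ + t) ⟩
  1ℚ + t                      ∎)
  where open ≤-Reasoning

Bernoulli : ∀ n {t} → 0ℚ ≤ 1ℚ + t → 1ℚ + ι n * t ≤ (1ℚ + t) ^ℚ n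
Bernoulli zero {t} _ = ≤-reflexive (trans (cong (λ z → 1ℚ + z) (*-zeroˡ t)) (+-identityʳ 1ℚ))
Bernoulli (suc n) {t} 0≤1+t = begin
  1ℚ + ι (suc n) * t                       ≡⟨ cong (λ x → 1ℚ + x * t) (ι-suc n) ⟩
  1ℚ + (1ℚ + ι n) * t                      ≤⟨ p≤p+q _ (0≤* (0≤ι n) (0≤x² t)) ⟩
  1ℚ + (1ℚ + ι n) * t + ι n * (t * t)      ≡⟨ solve 2 (λ i t → con 1ℚ :+ (con 1ℚ :+ i) :* t :+ i :* (t :* t) := (con 1ℚ :+ t) :* (con 1ℚ :+ i :* t)) refl (ι n) t ⟩
  (1ℚ + t) * (1ℚ + ι n * t)                ≤⟨ *-monoˡ 0≤1+t (Bernoulli n 0≤1+t) ⟩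
  (1ℚ + t) ^ℚ suc n                        ∎
  where open ≤-Reasoning

-- By Bernoulli's inequality the factors are at most (1 + t) ^ N and (1 - t) ^ N with N = (m + 1)(n
-- + 1), and (1 - t ²) ^ N ≤ 1.
pow-product≤1 : ∀ n m {t} → 0ℚ < 1ℚ + ι (suc m) * t → 0ℚ < 1ℚ + ι (suc n) * (- t) →
  (1ℚ + ι (suc m) * t) ^ℚ suc n * (1ℚ + ι (suc n) * (- t)) ^ℚ suc m ≤ 1ℚ
pow-product≤1 n m {t} 0<x 0<y = begin
  x ^ℚ suc n * y ^ℚ suc m      ≤⟨ *-mono-nonNeg (0≤pow (suc n) (0≤pow (suc m) 0≤1+t)) (0≤pow (suc m) (<⇒≤ 0<y))
                                   (pow-mono-≤ (suc n) (<⇒≤ 0<x) (Bernoulli (suc m) 0≤1+t))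
                                   (pow-mono-≤ (suc m) (<⇒≤ 0<y) (Bernoulli (suc n) 0≤1-t)) ⟩
  ((1ℚ + t) ^ℚ suc m) ^ℚ suc n * ((1ℚ + - t) ^ℚ suc n) ^ℚ suc m   ≡⟨ cong₂ _*_ (^-assocʳ (1ℚ + t) (suc m) (suc n))
                                   (trans (^-assocʳ (1ℚ + - t) (suc n) (suc m)) (cong ((1ℚ + - t) ^ℚ_) (ℕ.*-comm (suc n) (suc m)))) ⟩
  (1ℚ + t) ^ℚ N * (1ℚ + - t) ^ℚ N   ≡⟨ ^-distrib-* (1ℚ + t) (1ℚ + - t) N ⟨
  ((1ℚ + t) * (1ℚ + - t)) ^ℚ N      ≤⟨ pow-mono-≤ N (0≤* 0≤1+t 0≤1-t) 1-t²≤1 ⟩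
  1ℚ ^ℚ N                           ≡⟨ pow-1 N ⟩
  1ℚ                                ∎
  where
  open ≤-Reasoning
  x y : ℚ
  x = 1ℚ + ι (suc m) * t
  y = 1ℚ + ι (suc n) * (- t)
  N : ℕ
  N = suc m ℕ.* suc n
  0≤1+t : 0ℚ ≤ 1ℚ + t
  0≤1+t = 1+-nonNeg m 0<x
  0≤1-t : 0ℚ ≤ 1ℚ + - t
  0≤1-t = 1+-nonNeg n 0<y
  1-t²≤1 : (1ℚ + t) * (1ℚ + - t) ≤ 1ℚ
  1-t²≤1 = begin
    (1ℚ + t) * (1ℚ + - t)              ≤⟨ p≤p+q _ (0≤x² t) ⟩
    (1ℚ + t) * (1ℚ + - t) + t * t      ≡⟨ solve 1 (λ t → (con 1ℚ :+ t) :* (con 1ℚ :+ :- t) :+ t :* t := con 1ℚ) refl t ⟩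
    1ℚ                                 ∎

euler-product≤1 : ∀ p k l → 0ℚ < euler p k → 0ℚ < euler (- p) l → euler p k ^ℚ suc k * euler (- p) l ^ℚ suc l ≤ 1ℚ
euler-product≤1 p k l 0<x 0<y = subst₂ (λ x y → x ^ℚ suc k * y ^ℚ suc l ≤ 1ℚ) x≡ y≡
  (pow-product≤1 k l (subst (0ℚ <_) (sym x≡) 0<x) (subst (0ℚ <_) (sym y≡) 0<y))
  where
  open ≡-Reasoning
  t : ℚ
  -- With this t the factors of `pow-product≤1` become 1 + p/(k + 1) and 1 - p/(l + 1).
  t = p * (recip k * recip l)
  x≡ : 1ℚ + ι (suc l) * t ≡ euler p k
  x≡ = cong (λ z → 1ℚ + z) (begin
    ι (suc l) * (p * (recip k * recip l))  ≡⟨ solve 4 (λ i p r s → i :* (p :* (r :* s)) := p :* r :* (i :* s)) refl (ι (suc l)) p (recip k) (recip l) ⟩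
    p * recip k * (ι (suc l) * recip l)    ≡⟨ cong (p * recip k *_) (ι*recip l) ⟩
    p * recip k * 1ℚ                       ≡⟨ *-identityʳ (p * recip k) ⟩
    p * recip k                            ∎)
  y≡ : 1ℚ + ι (suc k) * (- t) ≡ euler (- p) l
  y≡ = cong (λ z → 1ℚ + z) (begin
    ι (suc k) * (- (p * (recip k * recip l)))  ≡⟨ solve 4 (λ i p r s → i :* (:- (p :* (r :* s))) := (:- p) :* s :* (i :* r)) refl (ι (suc k)) p (recip k) (recip l) ⟩
    - p * recip l * (ι (suc k) * recip k)      ≡⟨ cong (- p * recip l *_) (ι*recip k) ⟩
    - p * recip l * 1ℚ                         ≡⟨ *-identityʳ (- p * recip l) ⟩
    - p * recip l                              ∎)

euler-mono : ∀ {p q} k → p ≤ q → euler p k ≤ euler q k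
euler-mono k p≤q = +-monoʳ-≤ 1ℚ (*-monoʳ (0≤recip k) p≤q)

-- If y ≤ x, the two witnesses would push the product in `euler-product≤1` above 1. Comparisons of
-- exponentials and logarithms below reduce to this.
exp-separates : ∀ {x y p q} → x <e^ p → e^ q < y → p ≤ q → x < y
exp-separates {x} {y} {p} {q} (k , 0<P , x<P) (l , 0<Q , 1<yQ) p≤q = ≰⇒> λ y≤x → <-irrefl refl (<-≤-trans 1<yQ (begin
  y * euler (- q) l ^ℚ suc l                    ≤⟨ *-monoʳ (<⇒≤ (0<pow (suc l) 0<Q)) (<⇒≤ (≤-<-trans y≤x x<P)) ⟩
  euler p k ^ℚ suc k * euler (- q) l ^ℚ suc l   ≤⟨ *-monoˡ (<⇒≤ (0<pow (suc k) 0<P)) (pow-mono-≤ (suc l) (<⇒≤ 0<Q) Q≤Q′) ⟩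
  euler p k ^ℚ suc k * euler (- p) l ^ℚ suc l   ≤⟨ euler-product≤1 p k l 0<P (<-≤-trans 0<Q Q≤Q′) ⟩
  1ℚ                                            ∎))
  where
  open ≤-Reasoning
  Q≤Q′ : euler (- q) l ≤ euler (- p) l
  Q≤Q′ = euler-mono l (neg-antimono-≤ p≤q)

e^0< : ∀ {y} → 1ℚ < y → e^ 0ℚ < y
e^0< {y} 1<y = 0 , 0<1 , subst (1ℚ <_) (sym (*-identityʳ y)) 1<y

e^<⇒0< : ∀ {p x} → e^ p < x → 0ℚ < x
e^<⇒0< (k , 0<P , 1<xP) = *-cancelʳ-0< (0<pow (suc k) 0<P) (<-trans 0<1 1<xP)

-- The index stands for (k + 1)(L + 1) factors. Multiplying the exponent and the number of factors
-- by L + 1 leaves each factor unchanged, so bounds for e ^ p can be raised to powers.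
euler-scale : ∀ p k L → euler (ι (suc L) * p) (k ℕ.+ L ℕ.* suc k) ≡ euler p k
euler-scale p k L = cong (λ z → 1ℚ + z) (begin
  ι (suc L) * p * recip (k ℕ.+ L ℕ.* suc k)   ≡⟨ cong (ι (suc L) * p *_) (recip-* L k) ⟨
  ι (suc L) * p * (recip L * recip k)         ≡⟨ solve 4 (λ i p r s → i :* p :* (r :* s) := p :* s :* (i :* r)) refl (ι (suc L)) p (recip L) (recip k) ⟩
  p * recip k * (ι (suc L) * recip L)         ≡⟨ cong (p * recip k *_) (ι*recip L) ⟩
  p * recip k * 1ℚ                            ≡⟨ *-identityʳ (p * recip k) ⟩
  p * recip k                                 ∎)
  where open ≡-Reasoning

pow-suc-* : ∀ x k L → x ^ℚ suc (k ℕ.+ L ℕ.* suc k) ≡ (x ^ℚ suc k) ^ℚ suc L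
pow-suc-* x k L = trans (cong (x ^ℚ_) (ℕ.*-comm (suc L) (suc k))) (sym (^-assocʳ x (suc k) (suc L)))

exp<-pow : ∀ {p x} L → e^ p < x → e^ (ι (suc L) * p) < (x ^ℚ suc L)
exp<-pow {p} {x} L e@(k , 0<P , 1<xP) = k ℕ.+ L ℕ.* suc k , subst (0ℚ <_) (sym P≡) 0<P , (begin-strict
  1ℚ                                      ≡⟨ pow-1 (suc L) ⟨
  1ℚ ^ℚ suc L                             <⟨ pow-mono-< L 0≤1 1<xP ⟩
  (x * euler (- p) k ^ℚ suc k) ^ℚ suc L   ≡⟨ ^-distrib-* x _ (suc L) ⟩
  x ^ℚ suc L * (euler (- p) k ^ℚ suc k) ^ℚ suc L   ≡⟨ cong (x ^ℚ suc L *_) (pow-suc-* (euler (- p) k) k L) ⟨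
  x ^ℚ suc L * euler (- p) k ^ℚ suc (k ℕ.+ L ℕ.* suc k)   ≡⟨ cong (λ z → x ^ℚ suc L * z ^ℚ suc (k ℕ.+ L ℕ.* suc k)) P≡ ⟨
  x ^ℚ suc L * euler (- (ι (suc L) * p)) (k ℕ.+ L ℕ.* suc k) ^ℚ suc (k ℕ.+ L ℕ.* suc k)   ∎)
  where
  open ≤-Reasoning
  P≡ : euler (- (ι (suc L) * p)) (k ℕ.+ L ℕ.* suc k) ≡ euler (- p) k
  P≡ = trans (cong (λ q → euler q (k ℕ.+ L ℕ.* suc k)) (neg-distribʳ-* (ι (suc L)) p)) (euler-scale (- p) k L)

<exp-pow : ∀ {p x} L → 0ℚ ≤ x → x <e^ p → (x ^ℚ suc L) <e^ (ι (suc L) * p)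
<exp-pow {p} {x} L 0≤x (k , 0<P , x<P) = k ℕ.+ L ℕ.* suc k , subst (0ℚ <_) (sym (euler-scale p k L)) 0<P , (begin-strict
  x ^ℚ suc L                                              <⟨ pow-mono-< L 0≤x x<P ⟩
  (euler p k ^ℚ suc k) ^ℚ suc L                           ≡⟨ pow-suc-* (euler p k) k L ⟨
  euler p k ^ℚ suc (k ℕ.+ L ℕ.* suc k)                    ≡⟨ cong (_^ℚ suc (k ℕ.+ L ℕ.* suc k)) (euler-scale p k L) ⟨
  euler (ι (suc L) * p) (k ℕ.+ L ℕ.* suc k) ^ℚ suc (k ℕ.+ L ℕ.* suc k)   ∎)
  where open ≤-Reasoning

-- Cuts and logarithms

fromℚ-isReal : ∀ p → IsReal (fromℚ p)
fromℚ-isReal p = record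
  { lower-inhabited = p - 1ℚ , subst (p - 1ℚ <_) (+-identityʳ p) (+-monoʳ-< p {(- 1ℚ)} {0ℚ} (*<* ℤ.-<+))
  ; upper-inhabited = p + 1ℚ , subst (_< p + 1ℚ) (+-identityʳ p) (+-monoʳ-< p 0<1)
  ; lower-closed    = <-trans
  ; upper-closed    = λ q<r p<q → <-trans p<q q<r
  ; lower-open      = <-dense
  ; upper-open      = λ p<r → let q , p<q , q<r = <-dense p<r in q , q<r , p<q
  ; disjoint        = λ (q<p , p<q) → <-asym q<p p<q
  ; located         = located
  }
  where
  located : ∀ {q r} → q < r → q < p ⊎ p < r
  located {q} {r} q<r with q <? p
  ... | yes q<p = inj₁ q<p
  ... | no q≮p = inj₂ (≤-<-trans (≮⇒≥ q≮p) q<r)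

lower<upper : ∀ {x} → IsReal x → ∀ {p q} → lower x p → upper x q → p < q
lower<upper {x} real {p} {q} p<x x<q with <-cmp p q
... | tri< p<q _ _ = p<q
... | tri≈ _ refl _ = ⊥-elim (IsReal.disjoint real (p<x , x<q))
... | tri> _ _ q<p = ⊥-elim (IsReal.disjoint real (IsReal.lower-closed real q<p p<x , x<q))

p<q⊓r⇒p<q : ∀ {p} q r → p < q ⊓ r → p < q
p<q⊓r⇒p<q q r p< = <-≤-trans p< (p⊓q≤p q r)

p<q⊓r⇒p<r : ∀ {p} q r → p < q ⊓ r → p < r
p<q⊓r⇒p<r q r p< = <-≤-trans p< (p⊓q≤q q r)

-- The denominator works: for δ = (a + 1)/(d + 1), (d + 1) δ = a + 1.
archimedean : ∀ {δ} → 0ℚ < δ → ∃[ k ] (1ℚ ≤ ι (suc k) * δ)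
archimedean {mkℚ (ℤ.+ zero)  d _} (*<* (ℤ.+<+ ()))
archimedean {mkℚ ℤ.-[1+ n ]  d _} (*<* ())
archimedean {δ@(mkℚ +[1+ a ] d _)} _ = d , subst (1ℚ ≤_) (sym scaled) (ι-mono {1} {suc a} (ℕ.s≤s ℕ.z≤n))
  where
  open ≡-Reasoning
  scaled : ι (suc d) * δ ≡ ι (suc a)
  scaled = begin
    ι (suc d) * δ                                   ≡⟨ cong (ι (suc d) *_) (fromℚᵘ-toℚᵘ δ) ⟨
    ι (suc d) * fromℚᵘ (mkℚᵘ +[1+ a ] d)            ≡⟨ fromℚᵘ-homo-* (mkℚᵘ +[1+ d ] 0) (mkℚᵘ +[1+ a ] d) ⟩
    fromℚᵘ (mkℚᵘ +[1+ d ] 0 ℚᵘ.* mkℚᵘ +[1+ a ] d)   ≡⟨ fromℚᵘ-cong {mkℚᵘ +[1+ d ] 0 ℚᵘ.* mkℚᵘ +[1+ a ] d} {mkℚᵘ +[1+ a ] 0} (*≡* cross) ⟩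
    ι (suc a)                                       ∎
    where
    cross : +[1+ d ] ℤ.* +[1+ a ] ℤ.* ℤ.+ 1 ≡ +[1+ a ] ℤ.* +[1+ d ℕ.+ 0 ]
    cross = trans (ℤ.*-identityʳ (+[1+ d ] ℤ.* +[1+ a ])) (trans (ℤ.*-comm +[1+ d ] +[1+ a ])
      (cong (λ n → +[1+ a ] ℤ.* +[1+ n ]) (sym (ℕ.+-identityʳ d))))

log-ratio : Cut
log-ratio = log (fromℕ 3) /ᴿ log (fromℕ 4)

upper-log⇒0< : ∀ {n p} → 1 ℕ.≤ n → upper (log (fromℕ n)) p → 0ℚ < p
upper-log⇒0< {n} {p} 1≤n (r , n<r , r<e^p) = ≰⇒> λ p≤0 → <-irrefl refl (exp-separates {p = p} {q = 0ℚ} r<e^p (e^0< (≤-<-trans (ι-mono 1≤n) n<r)) p≤0)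

-- A rational lower bound of log 3 / log 4, as a₁ / b₂ with a₁ < log 3
-- and log 4 < b₂.
lower-log-ratio : ∀ {ρ} → 0ℚ < ρ → lower log-ratio ρ →
  ∃[ a₁ ] ∃[ b₂ ] (lower (log (fromℕ 3)) a₁ × upper (log (fromℕ 4)) b₂ × 0ℚ < a₁ × ρ * b₂ ≤ a₁)
lower-log-ratio {ρ} 0<ρ (a₁ , b₁ , c₁ , d₁ , a₁<log3 , log3<b₁ , (a₂ , b₂ , a₂<log4 , log4<b₂ , inverse) , _ , ρ<min)
  = a₁ , b₂ , a₁<log3 , log4<b₂ , 0<a₁ , (begin
    ρ * b₂           ≤⟨ *-monoʳ (<⇒≤ 0<b₂) (<⇒≤ ρ<a₁c₁) ⟩
    a₁ * c₁ * b₂     ≡⟨ *-assoc a₁ c₁ b₂ ⟩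
    a₁ * (c₁ * b₂)   ≤⟨ *-monoˡ (<⇒≤ 0<a₁) (<⇒≤ (c₁b₂<1 inverse)) ⟩
    a₁ * 1ℚ          ≡⟨ *-identityʳ a₁ ⟩
    a₁               ∎)
  where
  open ≤-Reasoning
  0<b₁ : 0ℚ < b₁
  0<b₁ = upper-log⇒0< {3} {b₁} (ℕ.s≤s ℕ.z≤n) log3<b₁
  0<b₂ : 0ℚ < b₂
  0<b₂ = upper-log⇒0< {4} {b₂} (ℕ.s≤s ℕ.z≤n) log4<b₂
  ρ<a₁c₁ : ρ < a₁ * c₁
  ρ<a₁c₁ = p<q⊓r⇒p<q (a₁ * c₁) (a₁ * d₁) (p<q⊓r⇒p<q _ _ ρ<min)
  ρ<b₁c₁ : ρ < b₁ * c₁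
  ρ<b₁c₁ = p<q⊓r⇒p<q (b₁ * c₁) (b₁ * d₁) (p<q⊓r⇒p<r ((a₁ * c₁) ⊓ (a₁ * d₁)) _ ρ<min)
  -- The sign of a₁ is still unknown, whereas b₁ > log 3 is positive: the product b₁ c₁ settles the
  -- sign of c₁, and then a₁ c₁ that of a₁.
  0<c₁ : 0ℚ < c₁
  0<c₁ = *-cancelˡ-0< 0<b₁ (<-trans 0<ρ ρ<b₁c₁)
  0<a₁ : 0ℚ < a₁
  0<a₁ = *-cancelʳ-0< 0<c₁ (<-trans 0<ρ ρ<a₁c₁)
  c₁b₂<1 : _ → c₁ * b₂ < 1ℚ
  c₁b₂<1 (inj₁ (_ , lt)) = lt
  c₁b₂<1 (inj₂ (b₂<0 , _)) = ⊥-elim (<-asym 0<b₂ b₂<0)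

log3<log4 : ∀ {a b} → lower (log (fromℕ 3)) a → upper (log (fromℕ 4)) b → a < b
log3<log4 {a} {b} (r , r<3 , e^a<r) (s , 4<s , s<e^b) = ≰⇒> λ b≤a →
  <-asym (exp-separates {p = b} {q = a} s<e^b e^a<r b≤a) (<-trans r<3 (≤-<-trans (ι-mono {3} {4} (ℕ.n≤1+n 3)) 4<s))

log-power-bound : ∀ {N k M c b} → N ℕ.^ suc k ℕ.≤ 4 ℕ.^ suc M →
  lower (log (fromℕ N)) c → upper (log (fromℕ 4)) b → ι (suc k) * c < ι (suc M) * b
log-power-bound {N} {k} {M} {c} {b} N^k≤4^M (r , r<N , e^c<r) (s , 4<s , s<e^b) = ≰⇒> λ Mb≤kc →
  <-asym (exp-separates {p = ι (suc M) * b} {q = ι (suc k) * c} (<exp-pow {b} {s} M (<⇒≤ (≤-<-trans (0≤ι 4) 4<s)) s<e^b) (exp<-pow {c} {r} k e^c<r) Mb≤kc) (begin-strict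
    r ^ℚ suc k              <⟨ pow-mono-< k (<⇒≤ (e^<⇒0< {c} {r} e^c<r)) r<N ⟩
    ι N ^ℚ suc k            ≡⟨ ι-^ N (suc k) ⟨
    ι (N ℕ.^ suc k)         ≤⟨ ι-mono N^k≤4^M ⟩
    ι (4 ℕ.^ suc M)         ≡⟨ ι-^ 4 (suc M) ⟩
    ι 4 ^ℚ suc M            <⟨ pow-mono-< M (0≤ι 4) 4<s ⟩
    s ^ℚ suc M              ∎)
  where open ≤-Reasoning

-- The lower bound with a real exponent

module Bound {δ : Cut} (δ-real : IsReal δ) {δ₀} (δ₀<δ : lower δ δ₀) (0<δ₀ : 0ℚ < δ₀)
  {k} (1≤kδ₀ : 1ℚ ≤ ι (suc k) * δ₀)
  {N L} (1≤N : 1 ℕ.≤ N) (N^k≤ : N ℕ.^ suc k ℕ.≤ 4 ℕ.^ (suc (suc k) ℕ.* suc L)) where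

  open ≤-Reasoning

  -- Here δ pays for the factor (k + 2)/(k + 1). With K′ = k + 2, the choice of k gives K′ δ₀ b₂ ≥
  -- b₂ > a₁, because log 3 < log 4, and removing this from K′ a₁ leaves at most (k + 1) a₁.
  slope : ∀ {a a₁ b₂} → 0ℚ < a₁ → a₁ < b₂ → (a + δ₀) * b₂ ≤ a₁ → ι (suc (suc k)) * (a * b₂) ≤ ι (suc k) * a₁
  slope {a} {a₁} {b₂} 0<a₁ a₁<b₂ aδ≤ = begin
    K′ * (a * b₂)                           ≡⟨ solve 4 (λ K a b d → K :* (a :* b) := K :* ((a :+ d) :* b) :- K :* (d :* b)) refl K′ a b₂ δ₀ ⟩
    K′ * ((a + δ₀) * b₂) - K′ * (δ₀ * b₂)   ≤⟨ +-mono-≤ (*-monoˡ (0≤ι (suc (suc k))) aδ≤) (neg-antimono-≤ a₁≤) ⟩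
    K′ * a₁ - a₁                            ≡⟨ cong (λ K → K * a₁ - a₁) (ι-suc (suc k)) ⟩
    (1ℚ + K) * a₁ - a₁                      ≡⟨ solve 2 (λ K a → (con 1ℚ :+ K) :* a :- a := K :* a) refl K a₁ ⟩
    K * a₁                                  ∎
    where
    K K′ : ℚ
    K = ι (suc k)
    K′ = ι (suc (suc k))
    a₁≤ : a₁ ≤ K′ * (δ₀ * b₂)
    a₁≤ = begin
      a₁                   ≤⟨ <⇒≤ a₁<b₂ ⟩
      b₂                   ≡⟨ *-identityˡ b₂ ⟨
      1ℚ * b₂              ≤⟨ *-monoʳ (<⇒≤ (<-trans 0<a₁ a₁<b₂)) (≤-trans 1≤kδ₀ (*-monoʳ (<⇒≤ 0<δ₀) (ι-mono (ℕ.n≤1+n (suc k))))) ⟩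
      K′ * δ₀ * b₂         ≡⟨ *-assoc K′ δ₀ b₂ ⟩
      K′ * (δ₀ * b₂)       ∎

  exponent-bound : ∀ {a c} → 0ℚ < a → lower (log-ratio -ᴿ δ) a → lower (log (fromℕ N)) c →
    ∃[ a₁ ] (lower (log (fromℕ 3)) a₁ × a * c ≤ ι (suc L) * a₁)
  exponent-bound {a} {c} 0<a (ρ , δ₁ , ρ<ratio , δ<δ₁ , a<ρ-δ₁) c<logN = proceed (lower-log-ratio (<-trans 0<a (≤-<-trans (p≤p+q a (<⇒≤ 0<δ₀)) a+δ₀<ρ)) ρ<ratio)
    where
    a+δ₀<ρ : a + δ₀ < ρ
    a+δ₀<ρ = begin-strict
      a + δ₀             <⟨ +-mono-< a<ρ-δ₁ (lower<upper δ-real δ₀<δ δ<δ₁) ⟩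
      ρ - δ₁ + δ₁        ≡⟨ solve 2 (λ r d → r :- d :+ d := r) refl ρ δ₁ ⟩
      ρ                  ∎
    proceed : _ → ∃[ a₁ ] (lower (log (fromℕ 3)) a₁ × a * c ≤ ι (suc L) * a₁)
    proceed (a₁ , b₂ , a₁<log3 , log4<b₂ , 0<a₁ , ρb₂≤a₁) = a₁ , a₁<log3 , *-cancelˡ-≤-pos (ι (suc k)) {{positive (0<ι {suc k} (ℕ.s≤s ℕ.z≤n))}} (begin
      ι (suc k) * (a * c)                            ≡⟨ solve 3 (λ k a c → k :* (a :* c) := a :* (k :* c)) refl (ι (suc k)) a c ⟩
      a * (ι (suc k) * c)                            ≤⟨ *-monoˡ (<⇒≤ 0<a) (<⇒≤ (log-power-bound {N} {k} {L ℕ.+ suc k ℕ.* suc L} {c} {b₂} N^k≤ c<logN log4<b₂)) ⟩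
      a * (ι (suc (suc k) ℕ.* suc L) * b₂)           ≡⟨ cong (λ x → a * (x * b₂)) (ι-* (suc (suc k)) (suc L)) ⟩
      a * (ι (suc (suc k)) * ι (suc L) * b₂)         ≡⟨ solve 4 (λ a k l b → a :* (k :* l :* b) := l :* (k :* (a :* b))) refl a (ι (suc (suc k))) (ι (suc L)) b₂ ⟩
      ι (suc L) * (ι (suc (suc k)) * (a * b₂))       ≤⟨ *-monoˡ (0≤ι (suc L)) (slope {a} {a₁} {b₂} 0<a₁ (log3<log4 {a₁} {b₂} a₁<log3 log4<b₂)
                                                          (≤-trans (*-monoʳ (<⇒≤ 0<b₂) (<⇒≤ a+δ₀<ρ)) ρb₂≤a₁)) ⟩
      ι (suc L) * (ι (suc k) * a₁)                   ≡⟨ solve 3 (λ l k a → l :* (k :* a) := k :* (l :* a)) refl (ι (suc L)) (ι (suc k)) a₁ ⟩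
      ι (suc k) * (ι (suc L) * a₁)                   ∎)
      where
      0<b₂ : 0ℚ < b₂
      0<b₂ = upper-log⇒0< {4} {b₂} (ℕ.s≤s ℕ.z≤n) log4<b₂

  power-bound : ∀ {r} → lower (fromℕ N ^ (log-ratio -ᴿ δ)) r → r ≤ ι (3 ℕ.^ suc L)
  power-bound {r} (p , (a , b , c , d , a<E , E<b , c<logN , logN<d , p<min) , r<e^p) = sign (0ℚ <? a)
    where
    p<ac : p < a * c
    p<ac = p<q⊓r⇒p<q (a * c) (a * d) (p<q⊓r⇒p<q _ _ p<min)
    p<ad : p < a * d
    p<ad = p<q⊓r⇒p<r (a * c) (a * d) (p<q⊓r⇒p<q _ _ p<min)

    small : p ≤ 0ℚ → r ≤ ι (3 ℕ.^ suc L)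
    small p≤0 = <⇒≤ (exp-separates {p = p} {q = 0ℚ} r<e^p (e^0< (<-≤-trans (*<* (ℤ.+<+ (ℕ.s≤s (ℕ.s≤s ℕ.z≤n)))) (ι-mono {3} (ℕ.*-monoʳ-≤ 3 (ℕ.m^n>0 3 L))))) p≤0)

    main : ∃[ a₁ ] (lower (log (fromℕ 3)) a₁ × a * c ≤ ι (suc L) * a₁) → r ≤ ι (3 ℕ.^ suc L)
    main (a₁ , (s , s<3 , e^a₁<s) , ac≤) = begin
      r                     ≤⟨ <⇒≤ (exp-separates {p = p} {q = ι (suc L) * a₁} r<e^p (exp<-pow {a₁} {s} L e^a₁<s) (≤-trans (<⇒≤ p<ac) ac≤)) ⟩
      s ^ℚ suc L            ≤⟨ pow-mono-≤ (suc L) (<⇒≤ (e^<⇒0< {a₁} {s} e^a₁<s)) (<⇒≤ s<3) ⟩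
      ι 3 ^ℚ suc L          ≡⟨ ι-^ 3 (suc L) ⟨
      ι (3 ℕ.^ suc L)       ∎

    sign : Dec (0ℚ < a) → r ≤ ι (3 ℕ.^ suc L)
    sign (yes 0<a) = main (exponent-bound 0<a a<E c<logN)
    -- The product with d is used because N ≥ 1 makes the upper bound d of log N positive, while c
    -- may be negative.
    sign (no 0≮a) = small (<⇒≤ (<-≤-trans p<ad (subst (_≤ 0ℚ) (*-comm d a)
      (*-nonNeg-nonPos (<⇒≤ (upper-log⇒0< {N} {d} 1≤N logN<d)) (≮⇒≥ 0≮a)))))

-- The sign of r selects the endpoint product: a r ≤ c r for r ≥ 0, and b r ≤ 0 ≤ B for r ≤ 0.
scaled-lower : ∀ {c y B} → 0ℚ < c → 0ℚ ≤ B → (∀ {r} → lower y r → c * r ≤ B) → fromℚ c *ᴿ y ≤ᴿ fromℚ B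
scaled-lower {c} {y} {B} 0<c 0≤B bound q (a , b , r , s , a<c , c<b , r<y , _ , q<min) with ≤-total 0ℚ r
... | inj₁ 0≤r = <-≤-trans (p<q⊓r⇒p<q (a * r) (a * s) (p<q⊓r⇒p<q _ _ q<min)) (≤-trans (*-monoʳ 0≤r (<⇒≤ a<c)) (bound r<y))
... | inj₂ r≤0 = <-≤-trans (p<q⊓r⇒p<q (b * r) (b * s) (p<q⊓r⇒p<r ((a * r) ⊓ (a * s)) _ q<min))
      (≤-trans (*-nonNeg-nonPos (<⇒≤ (<-trans 0<c c<b)) r≤0) 0≤B)

0<recip : ∀ k → 0ℚ < recip k
0<recip k = *-cancelˡ-0< {ι (suc k)} (0<ι {suc k} (ℕ.s≤s ℕ.z≤n)) (subst (0ℚ <_) (sym (ι*recip k)) 0<1)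

-- A rational δ₀ with 0 < δ₀ < δ determines k by (k + 1) δ₀ ≥ 1, and the constant is the reciprocal
-- of the one in `collisions-lower-bound`.
collision-density : ∀ δ → IsReal δ → fromℕ 0 <ᴿ δ →
  ∃[ c ] (IsReal c × fromℕ 0 <ᴿ c ×
    (∀ N → N ℕ.≥ 1 → c *ᴿ fromℕ N ^ (log-ratio -ᴿ δ) ≤ᴿ fromℕ (collisions N)))
collision-density δ δ-real (δ₀ , 0<δ₀ , δ₀<δ) = assemble (archimedean {δ₀} 0<δ₀)
  where
  open ≤-Reasoning

  density : ∀ {k} C N → 1ℚ ≤ ι (suc k) * δ₀ → N ℕ.≥ 1 →
    ∃[ L ] (1 ℕ.≤ L × N ℕ.^ suc k ℕ.≤ 4 ℕ.^ (suc (suc k) ℕ.* L) × 3 ℕ.^ L ℕ.≤ suc C ℕ.* collisions N) →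
    fromℚ (recip C) *ᴿ fromℕ N ^ (log-ratio -ᴿ δ) ≤ᴿ fromℕ (collisions N)
  density C N _     _   (zero , () , _)
  density {k} C N 1≤kδ₀ 1≤N (suc L , _ , N^k≤ , 3^L≤) =
    scaled-lower {recip C} {fromℕ N ^ (log-ratio -ᴿ δ)} (0<recip C) (0≤ι (collisions N)) λ {r} r< → begin
      recip C * r                                   ≤⟨ *-monoˡ (0≤recip C) (Bound.power-bound δ-real δ₀<δ 0<δ₀ {k} 1≤kδ₀ {N} {L} 1≤N N^k≤ r<) ⟩
      recip C * ι (3 ℕ.^ suc L)                     ≤⟨ *-monoˡ (0≤recip C) (ι-mono 3^L≤) ⟩
      recip C * ι (suc C ℕ.* collisions N)          ≡⟨ cong (recip C *_) (ι-* (suc C) (collisions N)) ⟩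
      recip C * (ι (suc C) * ι (collisions N))      ≡⟨ solve 3 (λ r C c → r :* (C :* c) := C :* r :* c) refl (recip C) (ι (suc C)) (ι (collisions N)) ⟩
      ι (suc C) * recip C * ι (collisions N)        ≡⟨ cong (_* ι (collisions N)) (ι*recip C) ⟩
      1ℚ * ι (collisions N)                         ≡⟨ *-identityˡ (ι (collisions N)) ⟩
      ι (collisions N)                              ∎

  package : ∀ {k} → 1ℚ ≤ ι (suc k) * δ₀ →
    ∃[ C ] (1 ℕ.≤ C × (∀ N → 1 ℕ.≤ N → ∃[ L ] (1 ℕ.≤ L × N ℕ.^ suc k ℕ.≤ 4 ℕ.^ (suc (suc k) ℕ.* L) × 3 ℕ.^ L ℕ.≤ C ℕ.* collisions N))) →
    _
  package _ (zero , () , _)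
  package {k} 1≤kδ₀ (suc C , _ , bound) = fromℚ (recip C) , fromℚ-isReal (recip C) , <-dense (0<recip C) ,
    λ N 1≤N → density {k} C N 1≤kδ₀ 1≤N (bound N 1≤N)

  assemble : ∃[ k ] (1ℚ ≤ ι (suc k) * δ₀) → _
  assemble (k , 1≤kδ₀) = package {k} 1≤kδ₀ (collisions-lower-bound (suc k) (ℕ.s≤s ℕ.z≤n))

theorem1p1 : (∀ m → ∃[ n ] (n ≥ m × digitSum 2 n ≡ digitSum 3 n)) ×
    (∀ (δ : Cut) → IsReal δ → fromℕ 0 <ᴿ δ →
    ∃[ c ] (IsReal c × fromℕ 0 <ᴿ c ×
    (∀ (N : ℕ) → N ≥ 1 →
    c *ᴿ fromℕ N ^ (log (fromℕ 3) /ᴿ log (fromℕ 4) -ᴿ δ)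
    ≤ᴿ fromℕ (collisions N))))
theorem1p1 = infinitely-many , collision-density
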